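{- $\mu(3,1,3)\geq 22$ and $\mu(3,1,4)\geq 19$.
   Context: A literal is a propositional variable $x$ or its negation $\overline{x}$; a clause is a finite set of literals not containing both a literal and its negation; a CNF formula is a finite set of clauses. A $(k,p,q)$-formula is a CNF formula in which every clause contains exactly $k$ distinct literals and every variable occurs positively in at most $p$ clauses and negatively in at most $q$ clauses. $\mu(k,p,q)$ denotes the number of clauses of a smallest unsatisfiable $(k,p,q)$-formula ($\infty$ if none exists). -}

module Defs where

open import Data.Nat using (ℕ; _≤_; _≥_)
import Data.Nat.Properties as ℕₚ
open import Data.Bool using (Bool; true; false; not)
open import Data.List using (List; length; filter)
open import Data.List.Relation.Unary.All using (All)
open import Data.List.Relation.Unary.Any using (Any)
open import Data.List.Relation.Unary.AllPairs using (AllPairs)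
open import Data.List.Relation.Unary.Unique.Propositional using (Unique)
open import Data.List.Relation.Binary.Permutation.Propositional using (_↭_)
open import Data.Product using (Σ; ∃; _×_)
open import Relation.Nullary using (¬_; yes; no)
open import Relation.Binary.Definitions using (DecidableEquality)
open import Relation.Binary.PropositionalEquality using (_≡_; refl; cong)
open import Relation.Nullary.Decidable using (map′)

data Literal : Set where
  pos : ℕ → Literal
  neg : ℕ → Literal

complement : Literal → Literal
complement (pos x) = neg x
complement (neg x) = pos x

pos-inj : ∀ {x y} → pos x ≡ pos y → x ≡ y
pos-inj refl = refl

neg-inj : ∀ {x y} → neg x ≡ neg y → x ≡ y
neg-inj refl = refl

_≟ₗ_ : DecidableEquality Literal
pos x ≟ₗ pos y = map′ (cong pos) pos-inj (x ℕₚ.≟ y)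
pos x ≟ₗ neg y = no (λ ())
neg x ≟ₗ pos y = no (λ ())
neg x ≟ₗ neg y = map′ (cong neg) neg-inj (x ℕₚ.≟ y)

open import Data.List.Membership.DecPropositional _≟ₗ_ using (_∈_; _∈?_)

-- A clause is a finite set of literals, represented as a duplicate-free
-- list, not containing both a literal and its negation.
Clause : Set
Clause = List Literal

IsClause : Clause → Set
IsClause C = Unique C × (∀ l → l ∈ C → ¬ (complement l ∈ C))

-- A CNF formula is a finite set of clauses: a list of clauses, no two of
-- which are equal as sets (for duplicate-free lists: permutations).
CNF : Set
CNF = List Clause

IsCNF : CNF → Set
IsCNF F = All IsClause F × AllPairs (λ C D → ¬ (C ↭ D)) F

occ : Literal → CNF → ℕ
occ l F = length (filter (λ C → l ∈? C) F)

Is-kpq-formula : ℕ → ℕ → ℕ → CNF → Set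
Is-kpq-formula k p q F =
  IsCNF F
  × All (λ C → length C ≡ k) F
  × (∀ x → occ (pos x) F ≤ p)
  × (∀ x → occ (neg x) F ≤ q)

Assignment : Set
Assignment = ℕ → Bool

evalLit : Assignment → Literal → Bool
evalLit α (pos x) = α x
evalLit α (neg x) = not (α x)

Satisfies : Assignment → CNF → Set
Satisfies α F = All (λ C → Any (λ l → evalLit α l ≡ true) C) F

Satisfiable : CNF → Set
Satisfiable F = ∃ λ α → Satisfies α F

Unsatisfiable : CNF → Set
Unsatisfiable F = ¬ Satisfiable F

-- "μ(k,p,q) ≥ m": every unsatisfiable (k,p,q)-formula has at least m
-- clauses (vacuously true when μ(k,p,q) = ∞).
μ≥ : ℕ → ℕ → ℕ → ℕ → Set
μ≥ k p q m = ∀ F → Is-kpq-formula k p q F → Unsatisfiable F → length F ≥ m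

{-# OPTIONS --safe #-}
module Submission where

-- Call a clause without negative literals a block.  Trace every variable back through its
-- unique positive occurrence: its support is the set of block variables that it descends
-- from.  Choose one variable in every block uniformly at random, make the other block
-- variables false, and make every variable false whose support was not chosen in full; only
-- the clauses C whose support S(C) was chosen survive, with probability at most 3^-|S(C)|.
-- As every surviving clause has a nonempty support, some choice leaves survivors with
-- Σ 3^|S(C)| at most the number of clauses other than blocks.  So few survivors remain that
-- they can be satisfied: those with supports of size one fall apart into one independent
-- piece per chosen variable, and a piece is satisfied by a random assignment in which the
-- two positive variables of one binary clause are made complementary.

open import Defs
import Algebra.Properties.CommutativeSemigroup as CommutativeSemigroupₚ
open import Data.Bool using (Bool; true; false; not)
import Data.Bool.Properties as Boolₚ
open import Data.List using (List; []; _∷_; length; map; filter; _++_; concatMap; deduplicate)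
open import Data.List.Membership.DecPropositional _≟ₗ_ using (_∈?_)
open import Data.List.Membership.Propositional using (_∈_; _∉_; find; lose)
open import Data.List.Membership.Propositional.Properties using
  (∈-map⁺; ∈-map⁻; ∈-concatMap⁺; ∈-concatMap⁻; ∈-++⁺ˡ; ∈-++⁺ʳ; ∈-++⁻; ∈-filter⁺; ∈-filter⁻;
   ∈-∃++; ∈-deduplicate⁺; ∈-deduplicate⁻)
open import Data.List.Properties using (length-map; length-++; length-++-sucʳ)
open import Data.List.Relation.Binary.Permutation.Propositional using (_↭_; ↭-reflexive)
open import Data.List.Relation.Binary.Subset.Propositional using (_⊆_)
open import Data.List.Relation.Unary.All as All using (All; []; _∷_)
import Data.List.Relation.Unary.All.Properties as Allₚ
open import Data.List.Relation.Unary.AllPairs using (AllPairs; []; _∷_)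
import Data.List.Relation.Unary.AllPairs.Properties as AllPairsₚ
open import Data.List.Relation.Unary.Any as Any using (Any; here; there; any?)
open import Data.List.Relation.Unary.Unique.Propositional using (Unique)
import Data.List.Relation.Unary.Unique.Propositional.Properties as Uniqueₚ
open import Data.Maybe as Maybe using (Maybe; just; nothing; fromMaybe)
open import Data.Maybe.Properties using (just-injective; ≡-dec)
open import Data.Nat
open import Data.Nat.Properties
open import Data.List.Relation.Unary.Unique.DecPropositional.Properties _≟_ using (deduplicate-!)
open import Data.Product using (∃; ∃₂; _×_; _,_; proj₁; proj₂)
open import Data.Sum using (_⊎_; inj₁; inj₂; [_,_]′)
open import Function using (_∘_; case_of_)
open import Relation.Binary.PropositionalEquality
open import Relation.Nullary using (¬_; Dec; yes; no; contradiction; _×-dec_)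
open import Relation.Unary using (Decidable)

-- With weights that are eight times the falsification probabilities, a random assignment satisfies
-- 3-clauses of total weight below 8. Up to six survivors of weight 2 would exceed this, hence the
-- pieces: a survivor with support {k} has weight 2 only if it contains the negation of k, which at
-- most q clauses do, so a piece weighs at most 6 + 3 for q = 3 and 5 + 4 for q = 4. Making two
-- variables of a clause of weight 2 complementary lowers 9 to 7, because elsewhere these variables
-- occur only negatively. The budget is counted in units of 12. Blocks do not survive, so fewer than
-- 21 units (q = 3) or 18 units (q = 4) remain, and a survivor costs 3, 9 or 27 units for a support
-- of size one, two or three. Let a negated block literal add a surcharge of e units. Blocks, with
-- three variables of three negative occurrences each, pay for it if 9e < 1. Two survivors with
-- supports of size two and two such literals each exhaust the budget if 2 * 9 * (1 + 2e) >= 21. The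
-- least such e is 1/12, hence the 12.

private
  module +ₚ = CommutativeSemigroupₚ +-commutativeSemigroup
  module *ₚ = CommutativeSemigroupₚ *-commutativeSemigroup

-- Finite sums and double counting

∑ : ∀ {A : Set} → List A → (A → ℕ) → ℕ
∑ []       f = 0
∑ (x ∷ xs) f = f x + ∑ xs f

module _ {A : Set} where

  ∑-mono : (xs : List A) {f g : A → ℕ} → (∀ {x} → x ∈ xs → f x ≤ g x) → ∑ xs f ≤ ∑ xs g
  ∑-mono []       f≤g = z≤n
  ∑-mono (x ∷ xs) f≤g = +-mono-≤ (f≤g (here refl)) (∑-mono xs (f≤g ∘ there))

  ∑-+ : (xs : List A) {f g : A → ℕ} → ∑ xs (λ x → f x + g x) ≡ ∑ xs f + ∑ xs g
  ∑-+ []       = refl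
  ∑-+ (x ∷ xs) {f} {g} rewrite ∑-+ xs {f} {g} = +ₚ.interchange (f x) (g x) (∑ xs f) (∑ xs g)

  ∑-* : (xs : List A) (k : ℕ) {f : A → ℕ} → ∑ xs (λ x → k * f x) ≡ k * ∑ xs f
  ∑-* []       k     = sym (*-zeroʳ k)
  ∑-* (x ∷ xs) k {f} rewrite ∑-* xs k {f} = sym (*-distribˡ-+ k (f x) (∑ xs f))

  ∑-∈ : {xs : List A} (f : A → ℕ) {x : A} → x ∈ xs → f x ≤ ∑ xs f
  ∑-∈ f (here refl) = m≤m+n _ _
  ∑-∈ f (there {x = y} x∈xs) = ≤-trans (∑-∈ f x∈xs) (m≤n+m _ (f y))

  ∑-mono-∈ : {xs : List A} {f g : A → ℕ} → (∀ {x} → x ∈ xs → f x ≤ g x) →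
             ∀ {c y} → y ∈ xs → c + f y ≤ g y → c + ∑ xs f ≤ ∑ xs g
  ∑-mono-∈ {xs = _ ∷ xs} {f} f≤g {c} {y} (here refl) c+fy≤gy =
    ≤-trans (≤-reflexive (sym (+-assoc c (f y) _))) (+-mono-≤ c+fy≤gy (∑-mono xs (f≤g ∘ there)))
  ∑-mono-∈ {xs = x ∷ xs} {f} f≤g {c} {y} (there y∈xs) c+fy≤gy =
    ≤-trans (≤-reflexive (+ₚ.x∙yz≈y∙xz c (f x) (∑ xs f)))
      (+-mono-≤ (f≤g (here refl)) (∑-mono-∈ (f≤g ∘ there) y∈xs c+fy≤gy))

indicator : ∀ {P : Set} → Dec P → ℕ
indicator (yes _) = 1
indicator (no _)  = 0

indicator-yes : ∀ {P : Set} (P? : Dec P) → P → indicator P? ≡ 1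
indicator-yes (yes _) _ = refl
indicator-yes (no ¬p) p = contradiction p ¬p

indicator-no : ∀ {P : Set} (P? : Dec P) → ¬ P → indicator P? ≡ 0
indicator-no (no _)  _  = refl
indicator-no (yes p) ¬p = contradiction p ¬p

indicator-mono : ∀ {P Q : Set} (P? : Dec P) (Q? : Dec Q) → (P → Q) → indicator P? ≤ indicator Q?
indicator-mono (no _)  _  _   = z≤n
indicator-mono (yes p) Q? P⇒Q = ≤-reflexive (sym (indicator-yes Q? (P⇒Q p)))

module _ {A : Set} {P : A → Set} (P? : Decidable P) where

  ∑-filter : ∀ xs (f : A → ℕ) → ∑ (filter P? xs) f ≡ ∑ xs λ x → indicator (P? x) * f x
  ∑-filter []       f = refl
  ∑-filter (x ∷ xs) f with P? x
  ... | yes _ = cong₂ _+_ (sym (+-identityʳ (f x))) (∑-filter xs f)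
  ... | no _  = ∑-filter xs f

  length-filter-∑ : ∀ xs → length (filter P? xs) ≡ ∑ xs λ x → indicator (P? x)
  length-filter-∑ []       = refl
  length-filter-∑ (x ∷ xs) with P? x
  ... | yes _ = cong suc (length-filter-∑ xs)
  ... | no _  = length-filter-∑ xs

∑-filter-≤ : ∀ {A : Set} {P : A → Set} (P? : Decidable P) xs (f : A → ℕ) → ∑ (filter P? xs) f ≤ ∑ xs f
∑-filter-≤ P? xs f = ≤-trans (≤-reflexive (∑-filter P? xs f))
  (∑-mono xs λ {x} _ → ≤-trans (*-monoˡ-≤ (f x) (indicator≤1 (P? x))) (≤-reflexive (+-identityʳ (f x))))
  where
  indicator≤1 : ∀ {P : Set} (P? : Dec P) → indicator P? ≤ 1
  indicator≤1 (yes _) = ≤-refl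
  indicator≤1 (no _)  = z≤n

∑-const : ∀ {A : Set} (xs : List A) c → ∑ xs (λ _ → c) ≡ length xs * c
∑-const []       c = refl
∑-const (x ∷ xs) c = cong (c +_) (∑-const xs c)

∑-swap : ∀ {A B : Set} (xs : List A) (ys : List B) (f : A → B → ℕ) →
         ∑ xs (λ x → ∑ ys (f x)) ≡ ∑ ys (λ y → ∑ xs λ x → f x y)
∑-swap []       ys f = sym (trans (∑-const ys 0) (*-zeroʳ (length ys)))
∑-swap (x ∷ xs) ys f = trans (cong (∑ ys (f x) +_) (∑-swap xs ys f)) (sym (∑-+ ys))

-- Distinct literals of `C` that lie in `N` use distinct entries of `N`. Repetitions in `N` only
-- enlarge the right side.
count-∈ : ∀ {C} → Unique C → ∀ N → ∑ C (λ l → indicator (l ∈? N)) ≤ ∑ N (λ n → indicator (n ∈? C))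
count-∈ {[]} _ N = z≤n
count-∈ {l ∷ C} (l∉C ∷ C!) N with l ∈? N
... | no _ = ≤-trans (count-∈ C! N) (∑-mono N λ {n} _ → indicator-mono (n ∈? C) (n ∈? (l ∷ C)) there)
... | yes l∈N = ≤-trans (s≤s (count-∈ C! N))
  (∑-mono-∈ (λ {n} _ → indicator-mono (n ∈? C) (n ∈? (l ∷ C)) there) {1} l∈N
    (≤-reflexive (trans (cong suc (indicator-no (l ∈? C) λ l∈C → All.lookup l∉C l∈C refl))
                        (sym (indicator-yes (l ∈? (l ∷ C)) (here refl))))))

-- Partial assignments and the expected number of falsified clauses

PartialAssignment : Set
PartialAssignment = ℕ → Maybe Bool

private variable
  C D : Clause
  l l′ : Literal
  x y z v w : ℕ
  U V : List ℕ
  σ τ : PartialAssignment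

value : PartialAssignment → Literal → Maybe Bool
value σ (pos x) = σ x
value σ (neg x) = Maybe.map not (σ x)

var : Literal → ℕ
var (pos x) = x
var (neg x) = x

sign : Literal → Bool
sign (pos x) = true
sign (neg x) = false

set : PartialAssignment → Literal → PartialAssignment
set σ l x with x ≟ var l
... | yes _ = just (sign l)
... | no  _ = σ x

infix 4 _⊑_

_⊑_ : PartialAssignment → PartialAssignment → Set
σ ⊑ τ = ∀ {x b} → σ x ≡ just b → τ x ≡ just b

⊑-value : σ ⊑ τ → ∀ l {b} → value σ l ≡ just b → value τ l ≡ just b
⊑-value σ⊑τ (pos x) eq = σ⊑τ eq
⊑-value {σ} σ⊑τ (neg x) eq with σ x in eq′
⊑-value {σ} σ⊑τ (neg x) refl | just b rewrite σ⊑τ eq′ = refl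

complement-involutive : ∀ l → complement (complement l) ≡ l
complement-involutive (pos x) = refl
complement-involutive (neg x) = refl

value-complement : ∀ l → value σ (complement l) ≡ Maybe.map not (value σ l)
value-complement (pos x) = refl
value-complement {σ} (neg x) with σ x
... | just b  = cong just (sym (Boolₚ.not-involutive b))
... | nothing = refl

value-nothing : ∀ l → σ (var l) ≡ nothing → value σ l ≡ nothing
value-nothing (pos x) eq = eq
value-nothing (neg x) eq rewrite eq = refl

var-nothing : ∀ l → value σ l ≡ nothing → σ (var l) ≡ nothing
var-nothing (pos x) eq = eq
var-nothing {σ} (neg x) eq with σ x
var-nothing (neg x) eq | nothing = refl

set-var : ∀ l → set σ l (var l) ≡ just (sign l)
set-var l with var l ≟ var l
... | yes _ = refl
... | no ≢  = contradiction refl ≢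

set-other : ∀ l → x ≢ var l → set σ l x ≡ σ x
set-other {x} l x≢ with x ≟ var l
... | yes x≡ = contradiction x≡ x≢
... | no _   = refl

value-set : ∀ l → value (set σ l) l ≡ just true
value-set {σ} (pos x) = set-var {σ} (pos x)
value-set {σ} (neg x) rewrite set-var {σ} (neg x) = refl

value-set-complement : ∀ l → value (set σ l) (complement l) ≡ just false
value-set-complement {σ} l rewrite value-complement {set σ l} l | value-set {σ} l = refl

same-var : ∀ l l′ → var l ≡ var l′ → l ≡ l′ ⊎ l ≡ complement l′
same-var (pos x) (pos .x) refl = inj₁ refl
same-var (pos x) (neg .x) refl = inj₂ refl
same-var (neg x) (pos .x) refl = inj₂ refl
same-var (neg x) (neg .x) refl = inj₁ refl

value-set-other : ∀ l l′ → var l′ ≢ var l → value (set σ l) l′ ≡ value σ l′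
value-set-other l (pos x) x≢ = set-other l x≢
value-set-other l (neg x) x≢ = cong (Maybe.map not) (set-other l x≢)

set-⊑ : ∀ l → σ (var l) ≡ nothing → σ ⊑ set σ l
set-⊑ {σ} l σl≡nothing {x} eq with x ≟ var l
... | yes refl = contradiction (trans (sym σl≡nothing) eq) λ ()
... | no _     = eq

factor : ℕ → Maybe Bool → ℕ
factor k nothing      = 1
factor k (just false) = k
factor k (just true)  = 0

-- k^|C| times the probability that C is falsified when every unassigned literal is
-- false with probability 1/k.
weight : ℕ → PartialAssignment → Clause → ℕ
weight k σ []      = 1
weight k σ (l ∷ C) = factor k (value σ l) * weight k σ C

module _ {k : ℕ} where

  weight-satisfied : l ∈ C → value σ l ≡ just true → weight k σ C ≡ 0
  weight-satisfied (here refl) eq rewrite eq = refl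
  weight-satisfied {C = l′ ∷ C} {σ} (there l∈C) eq
    rewrite weight-satisfied {σ = σ} l∈C eq = *-zeroʳ (factor k (value σ l′))

  factor-set : ∀ l l′ → value σ l ≡ nothing → l′ ≢ complement l →
               factor k (value (set σ l) l′) ≤ factor k (value σ l′)
  factor-set {σ} l l′ eq l′≢ with var l′ ≟ var l
  ... | no v≢ rewrite value-set-other {σ} l l′ v≢ = ≤-refl
  ... | yes v≡ with same-var l′ l v≡
  ...   | inj₁ refl rewrite value-set {σ} l = z≤n
  ...   | inj₂ l′≡ = contradiction l′≡ l′≢

  weight-set-∉ : ∀ l → value σ l ≡ nothing → ∀ C → complement l ∉ C →
                 weight k (set σ l) C ≤ weight k σ C
  weight-set-∉ l eq []       l∉C = ≤-refl
  weight-set-∉ l eq (l′ ∷ C) l∉C =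
    *-mono-≤ (factor-set l l′ eq (λ { refl → l∉C (here refl) })) (weight-set-∉ l eq C (l∉C ∘ there))

  weight-set : ∀ l → value σ l ≡ nothing → Unique C → complement l ∈ C →
               weight k (set σ l) C ≤ k * weight k σ C
  weight-set {σ} {C = _ ∷ C} l eq (l∉C ∷ _) (here refl)
    rewrite value-set-complement {σ} l | value-complement {σ} l | eq | +-identityʳ (weight k σ C) =
    *-monoʳ-≤ k (weight-set-∉ l eq C λ l∈C → All.lookup l∉C l∈C refl)
  weight-set {σ} {C = l′ ∷ C} l eq (l′∉C ∷ C!) (there l∈C) = begin
    factor k (value (set σ l) l′) * weight k (set σ l) C
      ≤⟨ *-mono-≤ (factor-set l l′ eq (All.lookup l′∉C l∈C)) (weight-set l eq C! l∈C) ⟩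
    factor k (value σ l′) * (k * weight k σ C)
      ≡⟨ *ₚ.x∙yz≈y∙xz (factor k (value σ l′)) k (weight k σ C) ⟩
    k * (factor k (value σ l′) * weight k σ C)
      ∎
    where open ≤-Reasoning

IsTrue IsUnset IsUnsetNegative : PartialAssignment → Literal → Set
IsTrue σ l = value σ l ≡ just true
IsUnset σ l = value σ l ≡ nothing
IsUnsetNegative σ l = IsUnset σ l × sign l ≡ false

Is3Clause : Clause → Set
Is3Clause C = IsClause C × length C ≡ 3

SatisfiedBy : Assignment → Clause → Set
SatisfiedBy α = Any λ l → evalLit α l ≡ true

Extension : PartialAssignment → CNF → Set
Extension σ G = ∃ λ α → σ ⊑ (just ∘ α) × (∀ {C} → C ∈ G → SatisfiedBy α C)

value-total : ∀ (α : Assignment) l → value (just ∘ α) l ≡ just (evalLit α l)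
value-total α (pos x) = refl
value-total α (neg x) = refl

⊑-true : ∀ {α} → σ ⊑ (just ∘ α) → ∀ l → IsTrue σ l → evalLit α l ≡ true
⊑-true {α = α} σ⊑α l eq = just-injective (trans (sym (value-total α l)) (⊑-value σ⊑α l eq))

default-false : PartialAssignment → Assignment
default-false σ = fromMaybe false ∘ σ

⊑-default : ∀ σ → σ ⊑ (just ∘ default-false σ)
⊑-default σ eq rewrite eq = refl

default-unset : ∀ l → IsUnsetNegative σ l → evalLit (default-false σ) l ≡ true
default-unset {σ} (neg x) (eq , _) with σ x
... | nothing = refl

-- An all-false clause attains the full weight `2 ^ length C`.
not-all-false : ∀ C → weight 2 σ C < 2 ^ length C → Any (λ l → IsTrue σ l ⊎ IsUnset σ l) C
not-all-false [] w<1 = contradiction w<1 (<-irrefl refl)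
not-all-false {σ} (l ∷ C) w< with value σ l in eq
... | nothing    = here (inj₂ eq)
... | just true  = here (inj₁ eq)
... | just false = there (not-all-false C (*-cancelˡ-< 2 _ _ w<))

-- One step of conditional expectations: the value that satisfies the clause brings its weight to 0,
-- the other at most doubles it.
branch : IsClause C → ∀ l → IsUnset σ l →
         weight 2 (set σ l) C + weight 2 (set σ (complement l)) C ≤ 2 * weight 2 σ C
branch {C} {σ} (C! , consistent) l unset with l ∈? C | complement l ∈? C
... | yes l∈C | yes l̅∈C = contradiction l̅∈C (consistent l l∈C)
... | yes l∈C | no _
  rewrite weight-satisfied {2} {σ = set σ l} l∈C (value-set {σ} l) =
  weight-set (complement l) (trans (value-complement {σ} l) (cong (Maybe.map not) unset)) C!
    (subst (_∈ C) (sym (complement-involutive l)) l∈C)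
... | no l∉C | yes l̅∈C
  rewrite weight-satisfied {2} {σ = set σ (complement l)} l̅∈C (value-set {σ} (complement l))
        | +-identityʳ (weight 2 (set σ l) C) =
  weight-set l unset C! l̅∈C
... | no l∉C | no l̅∉C rewrite +-identityʳ (weight 2 σ C) =
  +-mono-≤ (weight-set-∉ l unset C l̅∉C)
           (weight-set-∉ (complement l) (trans (value-complement {σ} l) (cong (Maybe.map not) unset)) C
              (subst (_∉ C) (sym (complement-involutive l)) l∉C))

one-below : ∀ a b {c n} → a + b ≤ 2 * c → c < n → a < n ⊎ b < n
one-below a b {c} {n} a+b≤2c c<n with a <? n | b <? n
... | yes a<n | _       = inj₁ a<n
... | no _    | yes b<n = inj₂ b<n
... | no a≮n  | no b≮n  = contradiction (≤-<-trans (≤-trans (+-mono-≤ (≮⇒≥ a≮n) (≮⇒≥ b≮n)) a+b≤2c)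
    (*-monoʳ-< 2 c<n)) (≤⇒≯ (≤-reflexive (cong (n +_) (+-identityʳ n))))

⊑-Extension : ∀ {σ τ G} → σ ⊑ τ → Extension τ G → Extension σ G
⊑-Extension σ⊑τ (α , τ⊑α , sat) = α , τ⊑α ∘ σ⊑τ , sat

set-nothing : ∀ l → set σ l x ≡ nothing → σ x ≡ nothing
set-nothing {x = x} l eq with x ≟ var l
set-nothing l () | yes _
set-nothing l eq | no _ = eq

-- `V` only bounds the variables still to be assigned, so that `extend` can recurse on it; it may
-- also contain others.
Covers : List ℕ → PartialAssignment → CNF → Set
Covers V σ G = ∀ {C} → C ∈ G → ∀ {l} → l ∈ C → σ (var l) ≡ nothing → var l ∈ V

covers-assigned : ∀ {G V v b} → σ v ≡ just b → Covers (v ∷ V) σ G → Covers V σ G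
covers-assigned eq covers C∈G l∈C unset with covers C∈G l∈C unset
... | here refl = contradiction (trans (sym eq) unset) λ ()
... | there ∈V  = ∈V

covers-set : ∀ {G V} l → IsUnset σ l → Covers (var l ∷ V) σ G → Covers V (set σ l) G
covers-set {σ} l unset covers = covers-assigned {set σ l} (set-var {σ} l) λ C∈G {l′} l′∈C unset′ →
  covers C∈G l′∈C (set-nothing {σ = σ} l unset′)

-- Satisfying formulas of weight below 8

module _ {G : CNF} (clauses : ∀ {C} → C ∈ G → Is3Clause C) where

  -- Derandomised first moment: a uniformly random completion falsifies less than one clause on
  -- average, and every variable has a value that preserves this. Once all variables are assigned, a
  -- falsified clause alone would weigh 8.
  extend : ∀ V σ → Covers V σ G → ∑ G (weight 2 σ) < 8 → Extension σ G
  extend [] σ covers ∑<8 = default-false σ , ⊑-default σ , λ {C} C∈G →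
    case find (not-all-false C (subst (λ n → weight 2 σ C < 2 ^ n) (sym (proj₂ (clauses C∈G)))
                                (≤-<-trans (∑-∈ (weight 2 σ) C∈G) ∑<8))) of λ where
      (l , l∈C , inj₁ true!) → lose l∈C (⊑-true (⊑-default σ) l true!)
      (l , l∈C , inj₂ unset) → case covers C∈G l∈C (var-nothing l unset) of λ ()
  extend (v ∷ V) σ covers ∑<8 with σ v in eq
  ... | just b = extend V σ (covers-assigned eq covers) ∑<8
  ... | nothing with one-below (∑ G (weight 2 (set σ (pos v)))) _ ∑≤ ∑<8
    where
    ∑≤ : ∑ G (weight 2 (set σ (pos v))) + ∑ G (weight 2 (set σ (neg v))) ≤ 2 * ∑ G (weight 2 σ)
    ∑≤ = subst₂ _≤_ (∑-+ G) (∑-* G 2) (∑-mono G λ C∈G → branch (proj₁ (clauses C∈G)) (pos v) eq)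
  ...   | inj₁ ∑<8′ = ⊑-Extension {σ} (set-⊑ {σ} (pos v) eq)
                        (extend V _ (covers-set {σ} (pos v) eq covers) ∑<8′)
  ...   | inj₂ ∑<8′ = ⊑-Extension {σ} (set-⊑ {σ} (neg v) eq)
                        (extend V _ (covers-set {σ} (neg v) (value-nothing {σ} (neg v) eq) covers) ∑<8′)

  extend-light : ∀ σ → ∑ G (weight 2 σ) < 8 → Extension σ G
  extend-light σ = extend (concatMap (map var) G) σ
    λ C∈G l∈C _ → ∈-concatMap⁺ (map var) (lose C∈G (∈-map⁺ var l∈C))

-- Formulas of weight up to 9

OpenPair : PartialAssignment → Clause → Set
OpenPair σ C = ∃₂ λ y z → y ≢ z × σ y ≡ nothing × σ z ≡ nothing × pos y ∈ C × pos z ∈ C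

-- A clause that already holds, or will hold once all unassigned variables become false.
Settled : PartialAssignment → Clause → Set
Settled σ C = Any (λ l → IsTrue σ l ⊎ IsUnsetNegative σ l) C

IsFalse : PartialAssignment → Literal → Set
IsFalse σ l = value σ l ≡ just false

Status : PartialAssignment → Literal → Set
Status σ l = (IsTrue σ l ⊎ IsUnsetNegative σ l) ⊎ IsFalse σ l ⊎ (∃ λ x → l ≡ pos x × σ x ≡ nothing)

status : ∀ σ l → Status σ l
status σ (pos x) with σ x in eq
... | just true  = inj₁ (inj₁ refl)
... | just false = inj₂ (inj₁ refl)
... | nothing    = inj₂ (inj₂ (x , refl , eq))
status σ (neg x) with σ x
... | just true  = inj₂ (inj₁ refl)
... | just false = inj₁ (inj₁ refl)
... | nothing    = inj₁ (inj₂ (refl , refl))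

-- If the negative literal `l` does not settle the clause, it is false and contributes a factor 2.
-- If the other two do not settle it either, each of them is false or positive and unassigned, and a
-- false one would raise the weight to at least 4.
settled-or-open-pair : Is3Clause C → weight 2 σ C ≤ 2 → l ∈ C → sign l ≡ false →
                       Settled σ C ⊎ (OpenPair σ C × 2 ≤ weight 2 σ C)
settled-or-open-pair {C} {σ} {l} C3 w≤2 l∈C l-neg with status σ l
... | inj₁ ok = inj₁ (lose l∈C ok)
... | inj₂ (inj₂ (_ , refl , _)) = case l-neg of λ ()
... | inj₂ (inj₁ l-false) = rest C3 l∈C w≤2
  where
  Result : Clause → Set
  Result C = Settled σ C ⊎ (OpenPair σ C × 2 ≤ weight 2 σ C)

  2*factors : Maybe Bool → Maybe Bool → ℕ
  2*factors a b = 2 * (factor 2 a * factor 2 b)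

  pair : ∀ {C m n} → m ≢ n → m ∈ C → n ∈ C → weight 2 σ C ≡ 2*factors (value σ m) (value σ n) →
         weight 2 σ C ≤ 2 → Result C
  pair {C} {m} {n} m≢n m∈C n∈C w≡ w≤2 with status σ m | status σ n
  ... | inj₁ ok | _ = inj₁ (lose m∈C ok)
  ... | inj₂ _ | inj₁ ok = inj₁ (lose n∈C ok)
  ... | inj₂ (inj₂ (y , refl , y?)) | inj₂ (inj₂ (z , refl , z?)) =
    inj₂ ((y , z , m≢n ∘ cong pos , y? , z? , m∈C , n∈C) ,
          ≤-reflexive (sym (trans w≡ (cong₂ 2*factors y? z?))))
  ... | inj₂ (inj₁ m-false) | inj₂ (inj₁ n-false) =
    contradiction (subst (_≤ 2) (trans w≡ (cong₂ 2*factors m-false n-false)) w≤2) λ { (s≤s (s≤s ())) }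
  ... | inj₂ (inj₁ m-false) | inj₂ (inj₂ (z , refl , z?)) =
    contradiction (subst (_≤ 2) (trans w≡ (cong₂ 2*factors m-false z?)) w≤2) λ { (s≤s (s≤s ())) }
  ... | inj₂ (inj₂ (y , refl , y?)) | inj₂ (inj₁ n-false) =
    contradiction (subst (_≤ 2) (trans w≡ (cong₂ 2*factors y? n-false)) w≤2) λ { (s≤s (s≤s ())) }

  rest : ∀ {C} → Is3Clause C → l ∈ C → weight 2 σ C ≤ 2 → Result C
  rest {_ ∷ m ∷ n ∷ []} ((((_ ∷ _) ∷ (m≢n ∷ []) ∷ _) , _) , _) (here refl) =
    pair m≢n (there (here refl)) (there (there (here refl)))
      (cong₂ _*_ (cong (factor 2) l-false) (cong (factor 2 (value σ m) *_) (*-identityʳ _)))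
  rest {m ∷ _ ∷ n ∷ []} ((((_ ∷ m≢n ∷ []) ∷ _) , _) , _) (there (here refl)) =
    pair m≢n (here refl) (there (there (here refl)))
      (trans (cong₂ (λ a b → factor 2 (value σ m) * (a * b)) (cong (factor 2) l-false)
                    (*-identityʳ (factor 2 (value σ n))))
             (*ₚ.x∙yz≈y∙xz (factor 2 (value σ m)) 2 _))
  rest {m ∷ n ∷ _ ∷ []} ((((m≢n ∷ _) ∷ _) , _) , _) (there (there (here refl))) =
    pair m≢n (here refl) (there (here refl))
      (trans (cong (λ a → factor 2 (value σ m) * (factor 2 (value σ n) * (a * 1))) (cong (factor 2) l-false))
             (*ₚ.x∙yz≈z∙xy (factor 2 (value σ m)) (factor 2 (value σ n)) 2))
search : ∀ {A : Set} {P Q : A → Set} (xs : List A) → (∀ {x} → x ∈ xs → P x ⊎ Q x) →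
         (∀ {x} → x ∈ xs → P x) ⊎ (∃ λ x → x ∈ xs × Q x)
search [] _ = inj₁ λ ()
search (x ∷ xs) dec with dec (here refl) | search xs (dec ∘ there)
... | inj₂ q | _ = inj₂ (x , here refl , q)
... | _ | inj₂ (y , y∈xs , q) = inj₂ (y , there y∈xs , q)
... | inj₁ p | inj₁ ps = inj₁ λ { (here refl) → p ; (there x∈xs) → ps x∈xs }

settled-default : Settled σ C → SatisfiedBy (default-false σ) C
settled-default {σ} = Any.map λ { {l} (inj₁ l-true) → ⊑-true (⊑-default σ) l l-true
                                ; {l} (inj₂ unset) → default-unset {σ} l unset }

choose : PartialAssignment → ℕ → ℕ → PartialAssignment
choose σ y z = set (set σ (pos y)) (neg z)

module _ {y z} (y≢z : y ≢ z) (y? : σ y ≡ nothing) (z? : σ z ≡ nothing) where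

  private
    z?′ : IsUnset (set σ (pos y)) (neg z)
    z?′ = value-nothing {set σ (pos y)} (neg z) (trans (set-other {σ = σ} (pos y) (y≢z ∘ sym)) z?)

  ⊑-choose : σ ⊑ choose σ y z
  ⊑-choose {x} eq = set-⊑ {set σ (pos y)} (neg z) (var-nothing {set σ (pos y)} (neg z) z?′) {x}
                      (set-⊑ {σ} (pos y) y? {x} eq)

  choose-y : value (choose σ y z) (pos y) ≡ just true
  choose-y = trans (value-set-other {set σ (pos y)} (neg z) (pos y) y≢z) (value-set {σ} (pos y))

  choose-z : value (choose σ y z) (neg z) ≡ just true
  choose-z = value-set {set σ (pos y)} (neg z)

  module _ (C! : Unique C) (z∉C : pos z ∉ C) where

    weight-choose-∉ : neg y ∉ C → weight 2 (choose σ y z) C ≤ weight 2 σ C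
    weight-choose-∉ ȳ∉C = ≤-trans (weight-set-∉ (neg z) z?′ C z∉C) (weight-set-∉ (pos y) y? C ȳ∉C)

    weight-choose-∈ : neg y ∈ C → weight 2 (choose σ y z) C ≤ 2 * weight 2 σ C
    weight-choose-∈ ȳ∈C = ≤-trans (weight-set-∉ (neg z) z?′ C z∉C) (weight-set (pos y) y? C! ȳ∈C)

-- The variables `y` and `z` occur at most negatively in `C`. If one of the negations is present,
-- the choice that makes it true satisfies the clause and the other choice at most doubles its
-- weight; if neither is, no choice makes the clause heavier.
branch-pair : ∀ {y z} → y ≢ z → σ y ≡ nothing → σ z ≡ nothing → Unique C → pos y ∉ C → pos z ∉ C →
              weight 2 (choose σ y z) C + weight 2 (choose σ z y) C ≤ 2 * weight 2 σ C
branch-pair {σ} {C} {y} {z} y≢z y? z? C! y∉C z∉C with neg y ∈? C | neg z ∈? C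
... | _ | yes z̄∈C rewrite weight-satisfied {2} {σ = choose σ y z} z̄∈C (choose-z {σ} y≢z y? z?) =
  weight-choose-∈ (y≢z ∘ sym) z? y? C! y∉C z̄∈C
... | yes ȳ∈C | no z̄∉C
  rewrite weight-satisfied {2} {σ = choose σ z y} ȳ∈C (choose-z {σ} (y≢z ∘ sym) z? y?)
        | +-identityʳ (weight 2 (choose σ y z) C) =
  weight-choose-∈ y≢z y? z? C! z∉C ȳ∈C
... | no ȳ∉C | no z̄∉C rewrite +-identityʳ (weight 2 σ C) =
  +-mono-≤ (weight-choose-∉ y≢z y? z? C! z∉C ȳ∉C) (weight-choose-∉ (y≢z ∘ sym) z? y? C! y∉C z̄∉C)

module _ {G : CNF} (clauses : ∀ {C} → C ∈ G → Is3Clause C)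
         (pos-once : ∀ {x C D} → C ∈ G → D ∈ G → pos x ∈ C → pos x ∈ D → C ≡ D) where

  -- Making y and z complementary keeps the expected weight of other clauses and removes that of A.
  extend-open-pair : ∀ σ → ∑ G (weight 2 σ) ≤ 9 → ∀ {A} → A ∈ G → OpenPair σ A → 2 ≤ weight 2 σ A → Extension σ G
  extend-open-pair σ ∑≤9 {A} A∈G (y , z , y≢z , y? , z? , y∈A , z∈A) 2≤w
    with one-below (∑ G w₁) (∑ G w₂) {7} {8} ∑≤14 (s≤s ≤-refl)
    where
    w₁ w₂ : Clause → ℕ
    w₁ = weight 2 (choose σ y z)
    w₂ = weight 2 (choose σ z y)

    at-A : w₁ A + w₂ A ≡ 0
    at-A = cong₂ _+_ (weight-satisfied {2} {σ = choose σ y z} y∈A (choose-y {σ} y≢z y? z?))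
                     (weight-satisfied {2} {σ = choose σ z y} z∈A (choose-y {σ} (y≢z ∘ sym) z? y?))

    pointwise : ∀ {C} → C ∈ G → w₁ C + w₂ C ≤ 2 * weight 2 σ C
    pointwise {C} C∈G with pos y ∈? C | pos z ∈? C
    ... | yes y∈C | _ rewrite pos-once C∈G A∈G y∈C y∈A | at-A = z≤n
    ... | no _ | yes z∈C rewrite pos-once C∈G A∈G z∈C z∈A | at-A = z≤n
    ... | no y∉C | no z∉C = branch-pair y≢z y? z? (proj₁ (proj₁ (clauses C∈G))) y∉C z∉C

    ∑≤14 : ∑ G w₁ + ∑ G w₂ ≤ 14
    -- `A` contributes 0 on the left and at least 2 * 2 on the right, and 18 - 4 = 14 leaves one of
    -- the two choices with weight at most 7.
    ∑≤14 = +-cancelˡ-≤ 4 _ _ (begin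
      4 + (∑ G w₁ + ∑ G w₂)            ≡⟨ cong (4 +_) (∑-+ G) ⟨
      4 + ∑ G (λ C → w₁ C + w₂ C)      ≤⟨ ∑-mono-∈ pointwise A∈G (≤-trans (≤-reflexive (cong (4 +_) at-A))
                                                          (*-monoʳ-≤ 2 2≤w)) ⟩
      ∑ G (λ C → 2 * weight 2 σ C)     ≡⟨ ∑-* G 2 ⟩
      2 * ∑ G (weight 2 σ)             ≤⟨ *-monoʳ-≤ 2 ∑≤9 ⟩
      18                               ∎)
      where open ≤-Reasoning
  ... | inj₁ ∑<8 = ⊑-Extension {σ} (⊑-choose y≢z y? z?) (extend-light clauses _ ∑<8)
  ... | inj₂ ∑<8 = ⊑-Extension {σ} (⊑-choose (y≢z ∘ sym) z? y?) (extend-light clauses _ ∑<8)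

  -- Either all clauses are settled and the unassigned variables can be made false, or an unsettled
  -- clause supplies an open pair together with a weight of at least 2 to be saved.
  extend-medium : ∀ σ → ∑ G (weight 2 σ) ≤ 9 →
    (∀ {C} → C ∈ G → Settled σ C ⊎ weight 2 σ C ≤ 2 × Any (λ l → sign l ≡ false) C) →
    Extension σ G
  extend-medium σ ∑≤9 hyp with search G classify
    where
    classify : ∀ {C} → C ∈ G → Settled σ C ⊎ (OpenPair σ C × 2 ≤ weight 2 σ C)
    classify C∈G with hyp C∈G
    ... | inj₁ ok = inj₁ ok
    ... | inj₂ (w≤2 , has-neg) with find has-neg
    ...   | l , l∈C , l-neg = settled-or-open-pair (clauses C∈G) w≤2 l∈C l-neg
  ... | inj₁ all-settled = default-false σ , ⊑-default σ , settled-default ∘ all-settled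
  ... | inj₂ (A , A∈G , open-pair , 2≤w) = extend-open-pair σ ∑≤9 A∈G open-pair 2≤w

-- Bounding weights by counting false literals

weight-unset : ∀ k L → weight k (λ _ → nothing) L ≡ 1
weight-unset k []           = refl
weight-unset k (pos _ ∷ L) = trans (+-identityʳ _) (weight-unset k L)
weight-unset k (neg _ ∷ L) = trans (+-identityʳ _) (weight-unset k L)

weight-all-false : ∀ k {σ} L → All (IsFalse σ) L → weight k σ L ≡ k ^ length L
weight-all-false k [] [] = refl
weight-all-false k (l ∷ L) (l-false ∷ L-false) rewrite l-false = cong (k *_) (weight-all-false k L L-false)

-- Only false literals multiply the weight, and by uniqueness they use distinct entries of `T`.
weight-≤-2^ : ∀ {σ C} → Unique C → ∀ T → (∀ {l} → l ∈ C → IsFalse σ l → l ∈ T) → weight 2 σ C ≤ 2 ^ length T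
weight-≤-2^ {C = []} _ T _ = m^n>0 2 (length T)
weight-≤-2^ {σ} {l ∷ C} (l∉C ∷ C!) T false∈T with value σ l in eq
... | just true = z≤n
... | nothing = ≤-trans (≤-reflexive (+-identityʳ _)) (weight-≤-2^ C! T (false∈T ∘ there))
... | just false with ∈-∃++ (false∈T (here refl) eq)
...   | xs , ys , refl = ≤-trans (*-monoʳ-≤ 2 (weight-≤-2^ C! (xs ++ ys) λ l′∈C l′-false →
          [ ∈-++⁺ˡ , (λ { (here refl) → contradiction refl (All.lookup l∉C l′∈C) ; (there ∈ys) → ∈-++⁺ʳ xs ∈ys }) ]′
            (∈-++⁻ xs (false∈T (there l′∈C) l′-false))))
        (≤-reflexive (cong (2 ^_) (sym (length-++-sucʳ xs l ys))))

weight-≤-2^∑ : ∀ {σ} C (c : Literal → ℕ) → (∀ {l} → l ∈ C → IsFalse σ l → c l ≡ 1) → weight 2 σ C ≤ 2 ^ ∑ C c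
weight-≤-2^∑ [] c _ = ≤-refl
weight-≤-2^∑ {σ} (l ∷ C) c false⇒1 = ≤-trans (*-mono-≤ factor≤ (weight-≤-2^∑ C c (false⇒1 ∘ there)))
                                         (≤-reflexive (sym (^-distribˡ-+-* 2 (c l) (∑ C c))))
  where
  factor≤ : factor 2 (value σ l) ≤ 2 ^ c l
  factor≤ with value σ l in eq
  ... | nothing    = m^n>0 2 (c l)
  ... | just true  = z≤n
  ... | just false rewrite false⇒1 (here refl) eq = ≤-refl

-- Without a true literal the weight is 2 to the number of false literals, and a weight of 3 or 4
-- makes that number two.
one-unset : ∀ {σ C} → Is3Clause C → ¬ Any (IsTrue σ) C → 3 ≤ weight 2 σ C → weight 2 σ C ≤ 4 →
            ∃ λ l → l ∈ C × IsUnset σ l × (∀ {l′} → l′ ∈ C → IsUnset σ l′ → l′ ≡ l)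
one-unset {σ} {l ∷ m ∷ n ∷ []} C3 ¬true 3≤w w≤4 with value σ l in eql | value σ m in eqm | value σ n in eqn
... | just true | _ | _ = contradiction (here eql) ¬true
... | _ | just true | _ = contradiction (there (here eqm)) ¬true
... | _ | _ | just true = contradiction (there (there (here eqn))) ¬true
... | just false | just false | just false = contradiction w≤4 λ { (s≤s (s≤s (s≤s (s≤s ())))) }
... | just false | nothing | nothing = contradiction 3≤w λ { (s≤s (s≤s ())) }
... | nothing | just false | nothing = contradiction 3≤w λ { (s≤s (s≤s ())) }
... | nothing | nothing | just false = contradiction 3≤w λ { (s≤s (s≤s ())) }
... | nothing | nothing | nothing = contradiction 3≤w λ { (s≤s ()) }
... | nothing | just false | just false = l , here refl , eql , λ where
  (here refl) _ → refl
  (there (here refl)) unset → case trans (sym eqm) unset of λ ()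
  (there (there (here refl))) unset → case trans (sym eqn) unset of λ ()
... | just false | nothing | just false = m , there (here refl) , eqm , λ where
  (here refl) unset → case trans (sym eql) unset of λ ()
  (there (here refl)) _ → refl
  (there (there (here refl))) unset → case trans (sym eqn) unset of λ ()
... | just false | just false | nothing = n , there (there (here refl)) , eqn , λ where
  (here refl) unset → case trans (sym eql) unset of λ ()
  (there (here refl)) unset → case trans (sym eqm) unset of λ ()
  (there (there (here refl))) _ → refl

-- Choosing one variable in every all-positive clause

choose₃ : PartialAssignment → ℕ → ℕ → ℕ → PartialAssignment
choose₃ τ x a b = set (choose τ x a) (neg b)

Negative Positive : Literal → Set
Negative l = sign l ≡ false
Positive l = sign l ≡ true

module _ {x a b} (x≢a : x ≢ a) (x≢b : x ≢ b) (a≢b : a ≢ b)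
         (x? : τ x ≡ nothing) (a? : τ a ≡ nothing) (b? : τ b ≡ nothing) where

  private
    τ₁ τ₂ τ₃ : PartialAssignment
    τ₁ = set τ (pos x)
    τ₂ = set τ₁ (neg a)
    τ₃ = set τ₂ (neg b)

    a?′ : τ₁ a ≡ nothing
    a?′ = trans (set-other {σ = τ} (pos x) (x≢a ∘ sym)) a?

    b?′ : τ₂ b ≡ nothing
    b?′ = trans (set-other {σ = τ₁} (neg a) (a≢b ∘ sym)) (trans (set-other {σ = τ} (pos x) (x≢b ∘ sym)) b?)

  ⊑-choose₃ : τ ⊑ choose₃ τ x a b
  ⊑-choose₃ {y} eq = set-⊑ {τ₂} (neg b) b?′ {y} (set-⊑ {τ₁} (neg a) a?′ {y} (set-⊑ {τ} (pos x) x? {y} eq))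

  choose₃-x : choose₃ τ x a b x ≡ just true
  choose₃-x = set-⊑ {τ₂} (neg b) b?′ {x} (set-⊑ {τ₁} (neg a) a?′ {x} (set-var {τ} (pos x)))

  choose₃-a : choose₃ τ x a b a ≡ just false
  choose₃-a = set-⊑ {τ₂} (neg b) b?′ {a} (set-var {τ₁} (neg a))

  choose₃-b : choose₃ τ x a b b ≡ just false
  choose₃-b = set-var {τ₂} (neg b)

  choose₃-other : ∀ {v} → v ≢ x → v ≢ a → v ≢ b → choose₃ τ x a b v ≡ τ v
  choose₃-other v≢x v≢a v≢b = trans (set-other {σ = τ₂} (neg b) v≢b)
    (trans (set-other {σ = τ₁} (neg a) v≢a) (set-other {σ = τ} (pos x) v≢x))

  module _ {L : List Literal} (L! : Unique L) (negative : ∀ {v} → pos v ∉ L) where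

    private
      ≤τ₁ : weight 3 τ₃ L ≤ weight 3 τ₁ L
      ≤τ₁ = ≤-trans (weight-set-∉ (neg b) (value-nothing {τ₂} (neg b) b?′) L negative)
                    (weight-set-∉ (neg a) (value-nothing {τ₁} (neg a) a?′) L negative)

    weight-choose₃ : weight 3 (choose₃ τ x a b) L ≤ 3 * weight 3 τ L
    weight-choose₃ with neg x ∈? L
    ... | yes x̄∈L = ≤-trans ≤τ₁ (weight-set (pos x) x? L! x̄∈L)
    ... | no x̄∉L = ≤-trans ≤τ₁ (≤-trans (weight-set-∉ (pos x) x? L x̄∉L) (m≤m+n _ _))

    weight-choose₃-∉ : neg x ∉ L → weight 3 (choose₃ τ x a b) L ≤ weight 3 τ L
    weight-choose₃-∉ x̄∉L = ≤-trans ≤τ₁ (weight-set-∉ (pos x) x? L x̄∉L)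

    weight-choose₃-∈ˡ : neg a ∈ L → weight 3 (choose₃ τ x a b) L ≡ 0
    weight-choose₃-∈ˡ ā∈L = weight-satisfied {3} {σ = τ₃} ā∈L (cong (Maybe.map not) choose₃-a)

    weight-choose₃-∈ʳ : neg b ∈ L → weight 3 (choose₃ τ x a b) L ≡ 0
    weight-choose₃-∈ʳ b̄∈L = weight-satisfied {3} {σ = τ₃} b̄∈L (cong (Maybe.map not) choose₃-b)

-- If `L` contains the negation of one of the three variables, the two choices that make this
-- variable false bring the weight to 0, and the third at most triples it. Positive literals are
-- excluded because the two rejected variables would falsify them.
branch₃ : ∀ {x a b} → x ≢ a → x ≢ b → a ≢ b → τ x ≡ nothing → τ a ≡ nothing → τ b ≡ nothing →
          ∀ {L} → Unique L → (∀ {v} → pos v ∉ L) →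
          weight 3 (choose₃ τ x a b) L + (weight 3 (choose₃ τ a x b) L + weight 3 (choose₃ τ b x a) L) ≤ 3 * weight 3 τ L
branch₃ {τ} {x} {a} {b} x≢a x≢b a≢b x? a? b? {L} L! negative with neg x ∈? L | neg a ∈? L | neg b ∈? L
... | yes x̄∈L | _ | _
  rewrite weight-choose₃-∈ˡ {τ} (x≢a ∘ sym) a≢b x≢b a? x? b? L! negative x̄∈L
        | weight-choose₃-∈ˡ {τ} (x≢b ∘ sym) (a≢b ∘ sym) x≢a b? x? a? L! negative x̄∈L
        | +-identityʳ (weight 3 (choose₃ τ x a b) L) = weight-choose₃ x≢a x≢b a≢b x? a? b? L! negative
... | no _ | yes ā∈L | _
  rewrite weight-choose₃-∈ˡ {τ} x≢a x≢b a≢b x? a? b? L! negative ā∈L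
        | weight-choose₃-∈ʳ {τ} (x≢b ∘ sym) (a≢b ∘ sym) x≢a b? x? a? L! negative ā∈L
        | +-identityʳ (weight 3 (choose₃ τ a x b) L) = weight-choose₃ (x≢a ∘ sym) a≢b x≢b a? x? b? L! negative
... | no _ | no _ | yes b̄∈L
  rewrite weight-choose₃-∈ʳ {τ} x≢a x≢b a≢b x? a? b? L! negative b̄∈L
        | weight-choose₃-∈ʳ {τ} (x≢a ∘ sym) a≢b x≢b a? x? b? L! negative b̄∈L =
  weight-choose₃ (x≢b ∘ sym) (a≢b ∘ sym) x≢a b? x? a? L! negative
... | no x̄∉L | no ā∉L | no b̄∉L rewrite +-identityʳ (weight 3 τ L) =
  +-mono-≤ (weight-choose₃-∉ x≢a x≢b a≢b x? a? b? L! negative x̄∉L)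
    (+-mono-≤ (weight-choose₃-∉ (x≢a ∘ sym) a≢b x≢b a? x? b? L! negative ā∉L)
              (weight-choose₃-∉ (x≢b ∘ sym) (a≢b ∘ sym) x≢a b? x? a? L! negative b̄∉L))

one-of-three : ∀ a b c {n} → a + (b + c) ≤ 3 * n → a ≤ n ⊎ b ≤ n ⊎ c ≤ n
one-of-three a b c {n} ∑≤ with a ≤? n | b ≤? n | c ≤? n
... | yes a≤n | _       | _       = inj₁ a≤n
... | no _    | yes b≤n | _       = inj₂ (inj₁ b≤n)
... | no _    | no _    | yes c≤n = inj₂ (inj₂ c≤n)
... | no a≰n  | no b≰n  | no c≰n  = contradiction ∑≤ (<⇒≱ (begin-strict
    3 * n        ≡⟨ cong (λ m → n + (n + m)) (+-identityʳ n) ⟩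
    n + (n + n)  <⟨ +-mono-< (≰⇒> a≰n) (+-mono-< (≰⇒> b≰n) (≰⇒> c≰n)) ⟩
    a + (b + c)  ∎))
  where open ≤-Reasoning

IsBlock : Clause → Set
IsBlock B = Is3Clause B × All Positive B

Untouched : PartialAssignment → List Clause → Set
Untouched τ Bs = ∀ {B} → B ∈ Bs → ∀ {l} → l ∈ B → τ (var l) ≡ nothing

record Selection (τ : PartialAssignment) (Bs : List Clause) (τ′ : PartialAssignment) : Set where
  field
    extends    : τ ⊑ τ′
    satisfied  : ∀ {B} → B ∈ Bs → Any (IsTrue τ′) B
    assigned   : ∀ {B} → B ∈ Bs → ∀ {l} → l ∈ B → τ′ (var l) ≢ nothing
    unassigned : ∀ {v} → (∀ {B} → B ∈ Bs → pos v ∉ B) → τ′ v ≡ τ v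

module _ {A : Set} (items : List A) (cost : A → ℕ) (L : A → List Literal)
         (L! : ∀ i → Unique (L i)) (negative : ∀ i {v} → pos v ∉ L i) where

  total : PartialAssignment → ℕ
  total τ = ∑ items λ i → cost i * weight 3 τ (L i)

  total-branch : ∀ {x a b} → x ≢ a → x ≢ b → a ≢ b → τ x ≡ nothing → τ a ≡ nothing → τ b ≡ nothing →
                 total (choose₃ τ x a b) ≤ total τ ⊎ total (choose₃ τ a x b) ≤ total τ ⊎ total (choose₃ τ b x a) ≤ total τ
  total-branch {τ} {x} {a} {b} x≢a x≢b a≢b x? a? b? = one-of-three _ _ _ (begin
    total (choose₃ τ x a b) + (total (choose₃ τ a x b) + total (choose₃ τ b x a))
      ≡⟨ cong (total (choose₃ τ x a b) +_) (∑-+ items) ⟨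
    total (choose₃ τ x a b) + ∑ items (λ i → w₂ i + w₃ i)
      ≡⟨ ∑-+ items ⟨
    ∑ items (λ i → w₁ i + (w₂ i + w₃ i))
      ≤⟨ ∑-mono items (λ {i} _ → pointwise i) ⟩
    ∑ items (λ i → 3 * (cost i * weight 3 τ (L i)))
      ≡⟨ ∑-* items 3 ⟩
    3 * total τ
      ∎)
    where
    open ≤-Reasoning
    w₁ w₂ w₃ : A → ℕ
    w₁ i = cost i * weight 3 (choose₃ τ x a b) (L i)
    w₂ i = cost i * weight 3 (choose₃ τ a x b) (L i)
    w₃ i = cost i * weight 3 (choose₃ τ b x a) (L i)
    pointwise : ∀ i → w₁ i + (w₂ i + w₃ i) ≤ 3 * (cost i * weight 3 τ (L i))
    pointwise i = begin
      w₁ i + (w₂ i + w₃ i)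
        ≡⟨ cong (w₁ i +_) (*-distribˡ-+ (cost i) _ _) ⟨
      w₁ i + cost i * (weight 3 (choose₃ τ a x b) (L i) + weight 3 (choose₃ τ b x a) (L i))
        ≡⟨ *-distribˡ-+ (cost i) _ _ ⟨
      cost i * (weight 3 (choose₃ τ x a b) (L i) + (weight 3 (choose₃ τ a x b) (L i) + weight 3 (choose₃ τ b x a) (L i)))
        ≤⟨ *-monoʳ-≤ (cost i) (branch₃ x≢a x≢b a≢b x? a? b? (L! i) (negative i)) ⟩
      cost i * (3 * weight 3 τ (L i))
        ≡⟨ *ₚ.x∙yz≈y∙xz (cost i) 3 _ ⟩
      3 * (cost i * weight 3 τ (L i)) ∎

  -- Conditional expectations with three outcomes per block. Since the blocks are disjoint, deciding
  -- one leaves the later ones untouched.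
  select : ∀ Bs τ → (∀ {B} → B ∈ Bs → IsBlock B) → AllPairs (λ B B′ → ∀ {l} → l ∈ B → l ∉ B′) Bs →
           Untouched τ Bs → ∃ λ τ′ → Selection τ Bs τ′ × total τ′ ≤ total τ
  select [] τ _ _ _ = τ , record
    { extends = λ eq → eq ; satisfied = λ () ; assigned = λ () ; unassigned = λ _ → refl } , ≤-refl
  select (B ∷ Bs) τ blocks (B# ∷ disjoint) untouched = go B refl (blocks (here refl))
    where
    Result : Set
    Result = ∃ λ τ′ → Selection τ (B ∷ Bs) τ′ × total τ′ ≤ total τ

    option : ∀ {x a b} → x ≢ a → x ≢ b → a ≢ b → τ x ≡ nothing → τ a ≡ nothing → τ b ≡ nothing →
             pos x ∈ B → pos a ∈ B → pos b ∈ B → (∀ {l} → l ∈ B → l ≡ pos x ⊎ l ≡ pos a ⊎ l ≡ pos b) →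
             total (choose₃ τ x a b) ≤ total τ → Result
    option {x} {a} {b} x≢a x≢b a≢b x? a? b? x∈B a∈B b∈B B⊆ ≤τ with select Bs τ₁ (blocks ∘ there) disjoint untouched₁
      where
      τ₁ : PartialAssignment
      τ₁ = choose₃ τ x a b
      untouched₁ : Untouched τ₁ Bs
      untouched₁ {B′} B′∈Bs {neg v} l∈B′ = case All.lookup (proj₂ (blocks (there B′∈Bs))) l∈B′ of λ ()
      untouched₁ {B′} B′∈Bs {pos v} l∈B′ = trans
        (choose₃-other x≢a x≢b a≢b x? a? b? (distinct x∈B) (distinct a∈B) (distinct b∈B))
        (untouched (there B′∈Bs) l∈B′)
        where
        distinct : ∀ {u} → pos u ∈ B → v ≢ u
        distinct u∈B refl = All.lookup B# B′∈Bs u∈B l∈B′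
    ... | τ′ , selection , ≤τ₁ = τ′ , record
      { extends    = λ {v} eq → extends {v} (⊑-choose₃ x≢a x≢b a≢b x? a? b? {v} eq)
      ; satisfied  = λ { (here refl) → lose x∈B x-true ; (there B∈) → satisfied B∈ }
      ; assigned   = λ { (here refl) l∈B → assigned-B (B⊆ l∈B) ; (there B∈) l∈ → assigned B∈ l∈ }
      ; unassigned = λ {v} v∉ → trans (unassigned (v∉ ∘ there))
          (choose₃-other x≢a x≢b a≢b x? a? b?
            (λ { refl → v∉ (here refl) x∈B }) (λ { refl → v∉ (here refl) a∈B }) (λ { refl → v∉ (here refl) b∈B }))
      } , ≤-trans ≤τ₁ ≤τ
      where
      open Selection selection
      x-true : τ′ x ≡ just true
      x-true = extends (choose₃-x x≢a x≢b a≢b x? a? b?)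
      a-false : τ′ a ≡ just false
      a-false = extends (choose₃-a x≢a x≢b a≢b x? a? b?)
      b-false : τ′ b ≡ just false
      b-false = extends (choose₃-b x≢a x≢b a≢b x? a? b?)
      assigned-B : ∀ {l} → l ≡ pos x ⊎ l ≡ pos a ⊎ l ≡ pos b → τ′ (var l) ≢ nothing
      assigned-B (inj₁ refl)        eq = case trans (sym eq) x-true of λ ()
      assigned-B (inj₂ (inj₁ refl)) eq = case trans (sym eq) a-false of λ ()
      assigned-B (inj₂ (inj₂ refl)) eq = case trans (sym eq) b-false of λ ()

    go : ∀ B′ → B′ ≡ B → IsBlock B′ → Result
    go (neg _ ∷ _) _ (_ , () ∷ _)
    go (_ ∷ neg _ ∷ _) _ (_ , _ ∷ () ∷ _)
    go (_ ∷ _ ∷ neg _ ∷ _) _ (_ , _ ∷ _ ∷ () ∷ _)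
    go (pos x ∷ pos a ∷ pos b ∷ []) refl
       (((((x≢a ∷ x≢b ∷ []) ∷ (a≢b ∷ []) ∷ _) , _) , _) , _) =
      case total-branch x≢a′ x≢b′ a≢b′ x? a? b? of λ where
        (inj₁ ≤τ) → option x≢a′ x≢b′ a≢b′ x? a? b? x∈B a∈B b∈B
          (λ { (here eq) → inj₁ eq ; (there (here eq)) → inj₂ (inj₁ eq) ; (there (there (here eq))) → inj₂ (inj₂ eq) }) ≤τ
        (inj₂ (inj₁ ≤τ)) → option (x≢a′ ∘ sym) a≢b′ x≢b′ a? x? b? a∈B x∈B b∈B
          (λ { (here eq) → inj₂ (inj₁ eq) ; (there (here eq)) → inj₁ eq ; (there (there (here eq))) → inj₂ (inj₂ eq) }) ≤τ
        (inj₂ (inj₂ ≤τ)) → option (x≢b′ ∘ sym) (a≢b′ ∘ sym) x≢a′ b? x? a? b∈B x∈B a∈B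
          (λ { (here eq) → inj₂ (inj₁ eq) ; (there (here eq)) → inj₂ (inj₂ eq) ; (there (there (here eq))) → inj₁ eq }) ≤τ
      where
      x∈B = here refl
      a∈B = there (here refl)
      b∈B = there (there (here refl))
      x≢a′ = x≢a ∘ cong pos
      x≢b′ = x≢b ∘ cong pos
      a≢b′ = a≢b ∘ cong pos
      x? = untouched (here refl) x∈B
      a? = untouched (here refl) a∈B
      b? = untouched (here refl) b∈B

-- Supports

IsRoot : Clause → Set
IsRoot = All Positive

root? : ∀ C → Dec (IsRoot C)
root? = All.all? λ l → sign l Boolₚ.≟ true

negative-literal : ¬ IsRoot C → ∃ λ w → neg w ∈ C
negative-literal ¬root with find (Allₚ.¬All⇒Any¬ (λ l → sign l Boolₚ.≟ true) _ ¬root)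
... | pos x , _   , ¬pos = contradiction refl ¬pos
... | neg w , w̄∈C , _    = w , w̄∈C

-- nothing marks a variable that does not descend from blocks; it can safely be made false.
Supports : Set
Supports = ℕ → Maybe (List ℕ)

private variable ρ ρ′ : Supports

-- A clause descends from blocks only if all of its negated variables do, hence `nothing` is
-- absorbing.
gather : Supports → Clause → Maybe (List ℕ)
gather ρ []          = just []
gather ρ (pos _ ∷ C) = gather ρ C
gather ρ (neg w ∷ C) with ρ w | gather ρ C
... | just U  | just V  = just (U ++ V)
... | just _  | nothing = nothing
... | nothing | _       = nothing

gather-⊇ : ∀ C → gather ρ C ≡ just U → neg w ∈ C → ∃ λ V → ρ w ≡ just V × V ⊆ U
gather-⊇ (pos _ ∷ C) eq (there w∈C) = gather-⊇ C eq w∈C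
gather-⊇ {ρ} (neg u ∷ C) eq w∈ with ρ u in equ | gather ρ C in eqC
gather-⊇ (neg u ∷ C) refl (here refl)  | just U | just V = U , equ , ∈-++⁺ˡ
gather-⊇ (neg u ∷ C) refl (there w̄∈C) | just U | just V with gather-⊇ C eqC w̄∈C
... | V′ , eqw , V′⊆V = V′ , eqw , ∈-++⁺ʳ U ∘ V′⊆V

gather-⊆ : ∀ C → gather ρ C ≡ just U → v ∈ U → ∃₂ λ w V → neg w ∈ C × ρ w ≡ just V × v ∈ V
gather-⊆ [] refl ()
gather-⊆ (pos _ ∷ C) eq v∈U with gather-⊆ C eq v∈U
... | w , V , w̄∈C , rest = w , V , there w̄∈C , rest
gather-⊆ {ρ} (neg u ∷ C) eq v∈U with ρ u in equ | gather ρ C in eqC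
gather-⊆ (neg u ∷ C) refl v∈U | just U | just V with ∈-++⁻ U v∈U
... | inj₁ v∈U′ = u , U , here refl , equ , v∈U′
... | inj₂ v∈V with gather-⊆ C eqC v∈V
...   | w , V′ , w̄∈C , rest = w , V′ , there w̄∈C , rest

gather-just : ∀ C → (∀ {w} → neg w ∈ C → ρ w ≢ nothing) → gather ρ C ≢ nothing
gather-just [] _ ()
gather-just (pos _ ∷ C) all-just eq = gather-just C (all-just ∘ there) eq
gather-just {ρ} (neg u ∷ C) all-just eq with ρ u in equ | gather ρ C in eqC
... | just _  | nothing = gather-just C (all-just ∘ there) eqC
... | nothing | _ = all-just (here refl) equ

infix 4 _≼_

_≼_ : Supports → Supports → Set
ρ ≼ ρ′ = ∀ {v U} → ρ v ≡ just U → ρ′ v ≡ just U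

gather-mono : ρ ≼ ρ′ → ∀ C → gather ρ C ≡ just U → gather ρ′ C ≡ just U
gather-mono ρ≼ [] eq = eq
gather-mono ρ≼ (pos _ ∷ C) eq = gather-mono ρ≼ C eq
gather-mono {ρ} ρ≼ (neg u ∷ C) eq with ρ u in equ | gather ρ C in eqC
gather-mono ρ≼ (neg u ∷ C) refl | just U | just V rewrite ρ≼ equ | gather-mono ρ≼ C eqC = refl

-- Repetitions are removed because a chosen variable accounts for one factor 3 only, however often
-- it is reached.
support : Supports → Clause → Maybe (List ℕ)
support ρ C = Maybe.map (deduplicate _≟_) (gather ρ C)

support-Unique : ∀ C → support ρ C ≡ just U → Unique U
support-Unique {ρ} C eq with gather ρ C
support-Unique C refl | just V = deduplicate-! V

support-⊇ : ∀ C → support ρ C ≡ just U → neg w ∈ C → ∃ λ V → ρ w ≡ just V × V ⊆ U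
support-⊇ {ρ} C eq w̄∈C with gather ρ C in eqC
support-⊇ C refl w̄∈C | just V with gather-⊇ C eqC w̄∈C
... | V′ , eqw , V′⊆V = V′ , eqw , ∈-deduplicate⁺ _≟_ ∘ V′⊆V

support-⊆ : ∀ C → support ρ C ≡ just U → v ∈ U → ∃₂ λ w V → neg w ∈ C × ρ w ≡ just V × v ∈ V
support-⊆ {ρ} C eq v∈U with gather ρ C in eqC
support-⊆ C refl v∈U | just V = gather-⊆ C eqC (∈-deduplicate⁻ _≟_ V v∈U)

support-just : ∀ C → (∀ {w} → neg w ∈ C → ρ w ≢ nothing) → support ρ C ≢ nothing
support-just {ρ} C all-just eq with gather ρ C in eqC
... | nothing = gather-just C all-just eqC

support-mono : ρ ≼ ρ′ → ∀ C → support ρ C ≡ just U → support ρ′ C ≡ just U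
support-mono {ρ} ρ≼ C eq with gather ρ C in eqC
support-mono ρ≼ C refl | just V rewrite gather-mono ρ≼ C eqC = refl

derive : Supports → Clause → ℕ → Maybe (List ℕ)
derive ρ C v with root? C
... | yes _ = just (v ∷ [])
... | no _  = support ρ C

derive-root : IsRoot C → derive ρ C v ≡ just (v ∷ [])
derive-root {C} root with root? C
... | yes _    = refl
... | no ¬root = contradiction root ¬root

derive-nonroot : ¬ IsRoot C → derive ρ C v ≡ support ρ C
derive-nonroot {C} ¬root with root? C
... | yes root = contradiction root ¬root
... | no _     = refl

derive-mono : ρ ≼ ρ′ → ∀ C → derive ρ C v ≡ just U → derive ρ′ C v ≡ just U
derive-mono ρ≼ C eq with root? C
... | yes _ = eq
... | no _  = support-mono ρ≼ C eq

stabilises : (g : ℕ → ℕ) (N : ℕ) → (∀ k → g k ≤ N) → ∃ λ k → g (suc k) ≤ g k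
stabilises g N g≤N = go (suc N) 0 (m≤n+m (suc N) (g 0))
  where
  go : ∀ n k → N < g k + n → ∃ λ k → g (suc k) ≤ g k
  go zero k N< = contradiction (≤-trans N< (≤-reflexive (+-identityʳ (g k)))) (≤⇒≯ (g≤N k))
  go (suc n) k N< with g (suc k) ≤? g k
  ... | yes g≤ = k , g≤
  ... | no g≰  = go n (suc k) (≤-trans N< (≤-trans (≤-reflexive (+-suc (g k) n)) (+-monoˡ-≤ n (≰⇒> g≰))))

record Supported (F : CNF) (ρ : Supports) : Set where
  field
    fixed    : C ∈ F → pos v ∈ C → ρ v ≡ derive ρ C v
    unique   : ρ v ≡ just U → Unique U
    nonempty : ρ v ≡ just U → ∃ λ s → s ∈ U
    roots    : ρ v ≡ just U → w ∈ U → ∃ λ B → B ∈ F × IsRoot B × pos w ∈ B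
    source   : ρ v ≡ just U → ∃ λ C → C ∈ F × pos v ∈ C

module _ (F : CNF) (pos-once : ∀ {x C D} → C ∈ F → D ∈ F → pos x ∈ C → pos x ∈ D → C ≡ D) where

  -- By `pos-once`, the clause found by the search is the only one that contains `pos v`.
  step : Supports → Supports
  step ρ v with any? (pos v ∈?_) F
  ... | yes v∈F = derive ρ (proj₁ (find v∈F)) v
  ... | no _    = nothing

  step-mono : ρ ≼ ρ′ → step ρ ≼ step ρ′
  step-mono ρ≼ {v} eq with any? (pos v ∈?_) F
  ... | yes v∈F = derive-mono ρ≼ (proj₁ (find v∈F)) eq

  step-derive : C ∈ F → pos v ∈ C → step ρ v ≡ derive ρ C v
  step-derive {C} {v} C∈F v∈C with any? (pos v ∈?_) F
  ... | no v∉F = contradiction (lose C∈F v∈C) v∉F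
  ... | yes v∈F with find v∈F
  ...   | D , D∈F , v∈D rewrite pos-once C∈F D∈F v∈C v∈D = refl

  step-source : step ρ v ≡ just U → ∃ λ C → C ∈ F × pos v ∈ C × derive ρ C v ≡ just U
  step-source {v = v} eq with any? (pos v ∈?_) F
  ... | yes v∈F with find v∈F
  ...   | C , C∈F , v∈C = C , C∈F , v∈C , eq

  -- Supports are the least fixed point of step, so circular definitions yield nothing.
  stage : ℕ → Supports
  stage zero    _ = nothing
  stage (suc k) = step (stage k)

  stage-mono : ∀ k → stage k ≼ stage (suc k)
  stage-mono zero    ()
  stage-mono (suc k) {v} = step-mono (λ {v} → stage-mono k {v}) {v}

  variables : List ℕ
  variables = concatMap (map var) F

  defined : Maybe (List ℕ) → ℕ
  defined (just _) = 1
  defined nothing  = 0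

  defined≤1 : ∀ m → defined m ≤ 1
  defined≤1 (just _) = ≤-refl
  defined≤1 nothing  = z≤n

  defined-mono : ∀ k v → defined (stage k v) ≤ defined (stage (suc k) v)
  defined-mono k v with stage k v in eq
  ... | nothing = z≤n
  ... | just U rewrite stage-mono k {v} eq = ≤-refl

  stage-unique : ∀ k → stage k v ≡ just U → Unique U
  stage-unique (suc k) eq with step-source {stage k} eq
  ... | C , _ , _ , eq′ with root? C
  stage-unique (suc k) eq | C , _ , _ , refl | yes _ = [] ∷ []
  ... | no _ = support-Unique C eq′

  stage-nonempty : ∀ k → stage k v ≡ just U → ∃ λ s → s ∈ U
  stage-nonempty (suc k) eq with step-source {stage k} eq
  ... | C , _ , _ , eq′ with root? C
  stage-nonempty {v} (suc k) eq | C , _ , _ , refl | yes _ = v , here refl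
  ... | no ¬root with negative-literal ¬root
  ...   | w , w̄∈C with support-⊇ C eq′ w̄∈C
  ...     | V , eqw , V⊆U with stage-nonempty k eqw
  ...       | s , s∈V = s , V⊆U s∈V

  stage-roots : ∀ k → stage k v ≡ just U → w ∈ U → ∃ λ B → B ∈ F × IsRoot B × pos w ∈ B
  stage-roots (suc k) eq w∈U with step-source {stage k} eq
  ... | C , C∈F , v∈C , eq′ with root? C
  stage-roots (suc k) eq (here refl) | C , C∈F , v∈C , refl | yes root = C , C∈F , root , v∈C
  ... | no _ with support-⊆ C eq′ w∈U
  ...   | u , V , _ , equ , w∈V = stage-roots k equ w∈V

  -- A support never changes once it is defined, so the number of defined variables grows strictly
  -- until two successive stages agree on the variables of `F`.
  supports : ∃ (Supported F)
  supports with stabilises (λ k → ∑ variables (λ v → defined (stage k v))) (∑ variables λ _ → 1)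
                  (λ k → ∑-mono variables λ {v} _ → defined≤1 (stage k v))
  ... | k , ∑≤ = stage k , record
    { fixed    = λ {C} {v} C∈F v∈C → trans (stable v (∈-concatMap⁺ (map var) (lose C∈F (∈-map⁺ var v∈C))))
                                           (step-derive C∈F v∈C)
    ; unique   = stage-unique k
    ; nonempty = stage-nonempty k
    ; roots    = stage-roots k
    ; source   = λ {v} eq → case step-source {stage k} (stage-mono k {v} eq) of λ (C , C∈F , v∈C , _) → C , C∈F , v∈C
    }
    where
    stable : ∀ v → v ∈ variables → stage k v ≡ stage (suc k) v
    stable v v∈V with stage k v in eq | stage (suc k) v in eq′
    ... | just U  | _       = trans (sym (stage-mono k {v} eq)) eq′
    ... | nothing | nothing = refl
    ... | nothing | just U  = contradiction
      (∑-mono-∈ (λ {u} _ → defined-mono k u) {1} v∈V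
        (≤-reflexive (trans (cong (suc ∘ defined) eq) (sym (cong defined eq′)))))
      (≤⇒≯ ∑≤)

-- The clauses that remain after a choice

module Analysis (F : CNF) (q : ℕ) (clauses : ∀ {C} → C ∈ F → Is3Clause C)
  (pos-once : ∀ {x C D} → C ∈ F → D ∈ F → pos x ∈ C → pos x ∈ D → C ≡ D)
  (neg-bound : ∀ x → occ (neg x) F ≤ q)
  (distinct : AllPairs (λ C D → ¬ (C ↭ D)) F)
  (ρ : Supports) (supported : Supported F ρ) where

  open Supported supported

  blocks : List Clause
  blocks = filter root? F

  negRoots : List Literal
  negRoots = concatMap (map complement) blocks

  RootVariable : ℕ → Set
  RootVariable w = ∃ λ B → B ∈ F × IsRoot B × pos w ∈ B

  neg-root : ∀ {w} → RootVariable w → neg w ∈ negRoots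
  neg-root (B , B∈F , root , w∈B) =
    ∈-concatMap⁺ (map complement) (lose (∈-filter⁺ root? B∈F root) (∈-map⁺ complement w∈B))

  uses : Clause → ℕ
  uses C = ∑ C λ l → indicator (l ∈? negRoots)

  -- A block has three variables, each with at most `q` negative occurrences.
  ∑-uses : ∑ F uses ≤ length blocks * 3 * q
  ∑-uses = begin
    ∑ F uses
      ≤⟨ ∑-mono F (λ C∈F → count-∈ (proj₁ (proj₁ (clauses C∈F))) negRoots) ⟩
    ∑ F (λ C → ∑ negRoots λ n → indicator (n ∈? C))
      ≡⟨ ∑-swap F negRoots _ ⟩
    ∑ negRoots (λ n → ∑ F λ C → indicator (n ∈? C))
      ≤⟨ ∑-mono negRoots (λ {n} n∈N → ≤-trans (≤-reflexive (sym (length-filter-∑ (n ∈?_) F))) (occ≤q n∈N)) ⟩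
    ∑ negRoots (λ _ → q)
      ≡⟨ ∑-const negRoots q ⟩
    length negRoots * q
      ≡⟨ cong (_* q) (length-negRoots blocks λ B∈ → proj₂ (clauses (proj₁ (∈-filter⁻ root? B∈)))) ⟩
    length blocks * 3 * q ∎
    where
    open ≤-Reasoning
    occ≤q : ∀ {n} → n ∈ negRoots → occ n F ≤ q
    occ≤q n∈N with find (∈-concatMap⁻ (map complement) n∈N)
    ... | B , B∈ , n∈B̄ with ∈-map⁻ complement n∈B̄
    ...   | pos w , _ , refl = neg-bound w
    ...   | neg w , w̄∈B , _ = case All.lookup (proj₂ (∈-filter⁻ root? {xs = F} B∈)) w̄∈B of λ ()
    length-negRoots : ∀ Bs → (∀ {B} → B ∈ Bs → length B ≡ 3) → length (concatMap (map complement) Bs) ≡ length Bs * 3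
    length-negRoots [] _ = refl
    length-negRoots (B ∷ Bs) size = trans (length-++ (map complement B))
      (cong₂ _+_ (trans (length-map complement B) (size (here refl))) (length-negRoots Bs (size ∘ there)))

  -- Every choice satisfies all blocks, so they receive `nothing` and therefore cost 0.
  clauseSupport : Clause → Maybe (List ℕ)
  clauseSupport C with root? C
  ... | yes _ = nothing
  ... | no _  = support ρ C

  module Cost (p : ℕ) where

    -- The surcharge on block literals is paid for by the blocks themselves, which do not
    -- count as survivors.  It is only needed for q = 3, to exclude two clauses like
    -- ¬x ∨ ¬x′ ∨ u and ¬x ∨ ¬x′ ∨ ¬u as the only survivors.
    cost : Clause → ℕ
    cost C = Maybe.maybe (λ _ → 12 + p * uses C) 0 (clauseSupport C)

    choices : Clause → List Literal
    choices C = Maybe.maybe (map neg) [] (clauseSupport C)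

    choices-unique : ∀ C → Unique (choices C)
    choices-unique C with root? C
    ... | yes _ = []
    ... | no _ with support ρ C in eq
    ...   | nothing = []
    ...   | just S  = Uniqueₚ.map⁺ neg-inj (support-Unique C eq)

    choices-negative : ∀ C {v} → pos v ∉ choices C
    choices-negative C v∈ with clauseSupport C
    ... | just S with ∈-map⁻ neg v∈
    ...   | _ , _ , ()

    -- Each block saves its own 12, and `∑-uses` bounds what the surcharges add.
    ∑-cost : ∑ F cost + length blocks * 12 ≤ length F * 12 + p * (length blocks * 3 * q)
    ∑-cost = begin
      ∑ F cost + length blocks * 12
        ≡⟨ cong (∑ F cost +_) (trans (sym (∑-const blocks 12)) (∑-filter root? F _)) ⟩
      ∑ F cost + ∑ F (λ C → indicator (root? C) * 12)
        ≡⟨ ∑-+ F ⟨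
      ∑ F (λ C → cost C + indicator (root? C) * 12)
        ≤⟨ ∑-mono F (λ {C} _ → pointwise C) ⟩
      ∑ F (λ C → 12 + p * uses C)
        ≡⟨ ∑-+ F ⟩
      ∑ F (λ _ → 12) + ∑ F (λ C → p * uses C)
        ≡⟨ cong₂ _+_ (∑-const F 12) (∑-* F p) ⟩
      length F * 12 + p * ∑ F uses
        ≤⟨ +-monoʳ-≤ (length F * 12) (*-monoʳ-≤ p ∑-uses) ⟩
      length F * 12 + p * (length blocks * 3 * q) ∎
      where
      open ≤-Reasoning
      pointwise : ∀ C → cost C + indicator (root? C) * 12 ≤ 12 + p * uses C
      pointwise C with root? C
      ... | yes _ = m≤m+n 12 _
      ... | no _ with support ρ C
      ...   | nothing = z≤n
      ...   | just _  = ≤-reflexive (+-identityʳ _)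

    total₀ : total F cost choices choices-unique choices-negative (λ _ → nothing) ≡ ∑ F cost
    total₀ = ≤-antisym (∑-mono F λ {C} _ → ≤-reflexive (eq C)) (∑-mono F λ {C} _ → ≤-reflexive (sym (eq C)))
      where
      eq : ∀ C → cost C * weight 3 (λ _ → nothing) (choices C) ≡ cost C
      eq C = trans (cong (cost C *_) (weight-unset 3 (choices C))) (*-identityʳ (cost C))

  -- The assignment induced by a choice, and its survivors

  module Chosen (τ : PartialAssignment) (selection : Selection (λ _ → nothing) blocks τ) where

    open Selection selection

    Selected : List ℕ → Set
    Selected = All λ v → τ v ≡ just true

    selected? : Decidable Selected
    selected? = All.all? λ v → ≡-dec Boolₚ._≟_ (τ v) (just true)

    resolve : Maybe Bool → Maybe (List ℕ) → Maybe Bool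
    resolve (just b) _ = just b
    resolve nothing nothing = just false
    resolve nothing (just S) with selected? S
    ... | yes _ = nothing
    ... | no _  = just false

    θ : PartialAssignment
    θ v = resolve (τ v) (ρ v)

    τ⊑θ : τ ⊑ θ
    τ⊑θ eq rewrite eq = refl

    root-variable : ∀ {w b} → τ w ≡ just b → RootVariable w
    root-variable {w} eq with any? (pos w ∈?_) blocks
    ... | no w∉ = case trans (sym (unassigned λ B∈ w∈B → w∉ (lose B∈ w∈B))) eq of λ ()
    ... | yes w∈ with find w∈
    ...   | B , B∈ , w∈B with ∈-filter⁻ root? {xs = F} B∈
    ...     | B∈F , root = B , B∈F , root , w∈B

    root-support : ∀ {w} → RootVariable w → ρ w ≡ just (w ∷ [])
    root-support (B , B∈F , root , w∈B) = trans (fixed B∈F w∈B) (derive-root root)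

    θ-true : ∀ {w} → θ w ≡ just true → τ w ≡ just true
    θ-true {w} eq with τ w | ρ w
    ... | just _ | _ = eq
    ... | nothing | just S with selected? S
    θ-true () | nothing | just S | yes _
    θ-true () | nothing | just S | no _

    θ-selected : ∀ {w} → θ w ≢ just false → ∃ λ T → ρ w ≡ just T × Selected T
    θ-selected {w} ≢false with τ w in eqτ
    ... | just true = w ∷ [] , root-support (root-variable eqτ) , eqτ ∷ []
    ... | just false = contradiction refl ≢false
    ... | nothing with ρ w
    ...   | nothing = contradiction refl ≢false
    ...   | just T with selected? T
    ...     | yes sel = T , refl , sel
    ...     | no _    = contradiction refl ≢false

    record Active (C : Clause) : Set where
      field
        nonroot  : ¬ IsRoot C
        not-true : ¬ Any (IsTrue θ) C
        S        : List ℕ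
        C-support : support ρ C ≡ just S
        selected : Selected S

    true? : ∀ C → Dec (Any (IsTrue θ) C)
    true? = any? λ l → ≡-dec Boolₚ._≟_ (value θ l) (just true)

    -- If no literal of a clause other than a block is true, none of its negated variables is false.
    -- Each of these then has a support that was chosen in full, and together these supports make up
    -- that of the clause.
    classify : ∀ {C} → C ∈ F → Any (IsTrue θ) C ⊎ Active C
    classify {C} C∈F with root? C
    ... | yes root = inj₁ (Any.map (λ {l} → ⊑-value {τ} (λ {v} → τ⊑θ {v}) l) (satisfied (∈-filter⁺ root? C∈F root)))
    ... | no nonroot with true? C
    ...   | yes true! = inj₁ true!
    ...   | no not-true with support ρ C in eq
    ...     | nothing = contradiction eq (support-just C λ w̄∈C eqw →
      case neg-selected w̄∈C of λ (_ , eqw′ , _) → case trans (sym eqw) eqw′ of λ ())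
      where
      neg-selected : ∀ {w} → neg w ∈ C → ∃ λ T → ρ w ≡ just T × Selected T
      neg-selected w̄∈C = θ-selected λ w-false → not-true (lose w̄∈C (cong (Maybe.map not) w-false))
    ...     | just S = inj₂ record
      { nonroot = nonroot ; not-true = not-true ; S = S ; C-support = eq ; selected = All.tabulate S-selected }
      where
      S-selected : ∀ {v} → v ∈ S → τ v ≡ just true
      S-selected v∈S with support-⊆ C eq v∈S
      ... | w , T , w̄∈C , eqw , v∈T with θ-selected {w} (λ w-false → not-true (lose w̄∈C (cong (Maybe.map not) w-false)))
      ...   | T′ , eqw′ , sel with just-injective (trans (sym eqw) eqw′)
      ...     | refl = All.lookup sel v∈T

    module _ {C} (C∈F : C ∈ F) (active : Active C) where

      open Active active

      S-unique : Unique S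
      S-unique = support-Unique C C-support

      active-pos : ∀ {v} → pos v ∈ C → ρ v ≡ just S
      active-pos v∈C = trans (fixed C∈F v∈C) (trans (derive-nonroot nonroot) C-support)

      active-neg : ∀ {w} → neg w ∈ C → ∃ λ T → ρ w ≡ just T × T ⊆ S
      active-neg = support-⊇ C C-support

      active-support : ∀ {l} → l ∈ C → ∃ λ T → ρ (var l) ≡ just T × T ⊆ S
      active-support {pos v} v∈C = S , active-pos v∈C , λ s∈S → s∈S
      active-support {neg w} w̄∈C = active-neg w̄∈C

      active-nonempty : ∃ λ s → s ∈ S
      active-nonempty with negative-literal nonroot
      ... | w , w̄∈C with active-neg w̄∈C
      ...   | T , eqw , T⊆S with nonempty eqw
      ...     | s , s∈T = s , T⊆S s∈T

      active-has-negative : Any Negative C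
      active-has-negative with negative-literal nonroot
      ... | w , w̄∈C = lose w̄∈C refl

      pos-not-assigned : ∀ {v b} → pos v ∈ C → τ v ≢ just b
      pos-not-assigned v∈C eq with root-variable eq
      ... | B , B∈F , root , v∈B = nonroot (subst IsRoot (pos-once B∈F C∈F v∈B v∈C) root)

      -- By `pos-once` the variable belongs to no block, and it inherits the chosen support of the
      -- clause.
      pos-unset : ∀ {v} → pos v ∈ C → θ v ≡ nothing
      pos-unset {v} v∈C with τ v in eqτ
      ... | just b = contradiction eqτ (pos-not-assigned v∈C)
      ... | nothing rewrite active-pos v∈C with selected? S
      ...   | yes _ = refl
      ...   | no ¬sel = contradiction selected ¬sel

      -- Positive literals of a survivor are unassigned, and `θ` makes only chosen block variables
      -- true. Such a variable is its own support, so it lies in `S`.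
      false-literal : ∀ {l} → l ∈ C → IsFalse θ l → ∃ λ w → l ≡ neg w × RootVariable w × w ∈ S
      false-literal {pos v} v∈C v-false = case trans (sym (pos-unset v∈C)) v-false of λ ()
      false-literal {neg w} w̄∈C w̄-false with root-variable (θ-true (not-false w̄-false))
        where
        not-false : Maybe.map not (θ w) ≡ just false → θ w ≡ just true
        not-false eq with θ w
        not-false refl | just true = refl
      ... | root with active-neg w̄∈C
      ...   | T , eqw , T⊆S with just-injective (trans (sym eqw) (root-support root))
      ...     | refl = w , refl , root , T⊆S (here refl)

      false∈S : ∀ {l} → l ∈ C → IsFalse θ l → l ∈ map neg S
      false∈S l∈C l-false with false-literal l∈C l-false
      ... | w , refl , _ , w∈S = ∈-map⁺ neg w∈S

      active-weight : weight 2 θ C ≤ 2 ^ length S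
      active-weight = ≤-trans (weight-≤-2^ (proj₁ (proj₁ (clauses C∈F))) (map neg S) false∈S)
                              (≤-reflexive (cong (2 ^_) (length-map neg S)))

      -- Adjoining the false literal `neg k` doubles the weight, while all false literals still come
      -- from `S`.
      active-weight-∉ : ∀ {k} → k ∈ S → neg k ∉ C → 2 * weight 2 θ C ≤ 2 ^ length S
      active-weight-∉ {k} k∈S k̄∉C = begin
        2 * weight 2 θ C        ≡⟨ cong (λ v → factor 2 v * weight 2 θ C) k̄-false ⟨
        weight 2 θ (neg k ∷ C)  ≤⟨ weight-≤-2^ {C = neg k ∷ C}
                                     (All.tabulate (λ { l∈C refl → k̄∉C l∈C }) ∷ proj₁ (proj₁ (clauses C∈F)))
                                     (map neg S) (λ { (here refl) _ → ∈-map⁺ neg k∈S ; (there l∈C) → false∈S l∈C }) ⟩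
        2 ^ length (map neg S)  ≡⟨ cong (2 ^_) (length-map neg S) ⟩
        2 ^ length S            ∎
        where
        open ≤-Reasoning
        k̄-false : value θ (neg k) ≡ just false
        k̄-false = cong (Maybe.map not) (τ⊑θ {k} (All.lookup selected k∈S))

      active-uses : weight 2 θ C ≤ 2 ^ uses C
      active-uses = weight-≤-2^∑ C _ λ {l} l∈C l-false → case false-literal l∈C l-false of λ where
        (w , refl , root , _) → indicator-yes (neg w ∈? negRoots) (neg-root root)

    -- Satisfied clauses get 0; since supports are nonempty, this tells them apart from the
    -- survivors.
    size : Clause → ℕ
    size C with true? C
    ... | yes _ = 0
    ... | no _  = Maybe.maybe length 0 (support ρ C)

    size-true : ∀ {C} → Any (IsTrue θ) C → size C ≡ 0
    size-true {C} true! with true? C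
    ... | yes _ = refl
    ... | no ¬true = contradiction true! ¬true

    size-active : ∀ {C} (active : Active C) → size C ≡ length (Active.S active)
    size-active {C} active with true? C
    ... | yes true! = contradiction true! (Active.not-true active)
    ... | no _ rewrite Active.C-support active = refl

    weight-true : ∀ {C} → Any (IsTrue θ) C → weight 2 θ C ≡ 0
    weight-true true! with find true!
    ... | l , l∈C , l-true = weight-satisfied {2} {σ = θ} l∈C l-true

    nonempty-length : ∀ {s} {S : List ℕ} → s ∈ S → 1 ≤ length S
    nonempty-length {S = _ ∷ _} _ = s≤s z≤n

    data View (C : Clause) : Set where
      holds : Any (IsTrue θ) C → size C ≡ 0 → weight 2 θ C ≡ 0 → View C
      active : (A : Active C) → size C ≡ length (Active.S A) → 1 ≤ size C → View C

    view : ∀ {C} → C ∈ F → View C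
    view C∈F with classify C∈F
    ... | inj₁ true! = holds true! (size-true true!) (weight-true true!)
    ... | inj₂ A = active A (size-active A)
      (≤-trans (nonempty-length (proj₂ (active-nonempty C∈F A))) (≤-reflexive (sym (size-active A))))

    weight-size : ∀ {C} → C ∈ F → 1 ≤ size C → weight 2 θ C ≤ 2 ^ size C
    weight-size C∈F 1≤ with view C∈F
    ... | holds _ size≡0 _ = case subst (1 ≤_) size≡0 1≤ of λ ()
    ... | active A eq _ rewrite eq = active-weight C∈F A

    -- Survivors by support size, and their pieces

    single? : Decidable λ C → size C ≡ 1
    single? C = size C ≟ 1

    double? : Decidable λ C → 2 ≤ size C
    double? C = 2 ≤? size C

    singles : ℕ
    singles = length (filter single? F)

    doubles : List Clause
    doubles = filter double? F

    head : Maybe (List ℕ) → ℕ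
    head (just (s ∷ _)) = s
    head _              = 0

    -- Any element of the support serves: the supports of the variables of a survivor lie inside its
    -- own support, and so do their keys.
    key : ℕ → ℕ
    key v = head (ρ v)

    module _ {C} (C∈F : C ∈ F) (A : Active C) where

      open Active A

      key∈S : ∀ {l} → l ∈ C → key (var l) ∈ S
      key∈S l∈C with active-support C∈F A l∈C
      ... | T , eq , T⊆S with nonempty eq
      ...   | _ , s∈T rewrite eq with T | s∈T
      ...     | t ∷ _ | _ = T⊆S (here refl)

      -- A support of at most two variables falsifies at most two of the three literals.
      unset-literal : size C ≤ 2 → ∃ λ l → l ∈ C × IsUnset θ l
      unset-literal size≤2 with find (not-all-false C w<8)
        where
        w<8 : weight 2 θ C < 2 ^ length C
        w<8 rewrite proj₂ (clauses C∈F) = s≤s (≤-trans (active-weight C∈F A)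
          (≤-trans (^-monoʳ-≤ 2 (subst (_≤ 2) (size-active A) size≤2)) (m≤m+n 4 3)))
      ... | l , l∈C , inj₁ l-true = contradiction (lose l∈C l-true) not-true
      ... | l , l∈C , inj₂ unset  = l , l∈C , unset

    singleton : ∀ {S : List ℕ} {s t} → length S ≡ 1 → s ∈ S → t ∈ S → s ≡ t
    singleton {_ ∷ []} _ (here refl) (here refl) = refl

    -- Unassigned variables with different keys never share a surviving clause, so the pieces
    -- can be satisfied independently of each other.
    module Glue (size≤2 : ∀ {C} → C ∈ F → size C ≤ 2) (bound : singles + length doubles * 3 + q ≤ 9)
      (forced : ∀ {D} → D ∈ doubles →
        ∃ λ l → l ∈ D × IsUnsetNegative θ l × (∀ {l′} → l′ ∈ D → IsUnset θ l′ → l′ ≡ l)) where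

      keyed? : ∀ k → Decidable (Any λ l → IsUnset θ l × key (var l) ≡ k)
      keyed? k = any? λ l → ≡-dec Boolₚ._≟_ (value θ l) nothing ×-dec key (var l) ≟ k

      piece : ℕ → CNF
      piece k = filter (keyed? k) F

      piece⊆ : ∀ k {C} → C ∈ piece k → C ∈ F
      piece⊆ k C∈ = proj₁ (∈-filter⁻ (keyed? k) C∈)

      -- A survivor with support {k, k′} has weight 4 only if it contains both ¬k and ¬k′.
      charge : ℕ → Clause → ℕ
      charge k C = indicator (single? C) * 1 + indicator (double? C) * 3 + indicator (neg k ∈? C)

      ∑-charge : ∀ k → ∑ F (charge k) ≤ 9
      ∑-charge k = begin
        ∑ F (charge k)
          ≡⟨ trans (∑-+ F) (cong (_+ ∑ F λ C → indicator (neg k ∈? C)) (∑-+ F)) ⟩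
        ∑ F (λ C → indicator (single? C) * 1) + ∑ F (λ C → indicator (double? C) * 3) + ∑ F (λ C → indicator (neg k ∈? C))
          ≡⟨ cong₂ _+_ (cong₂ _+_ (trans (sym (∑-filter single? F _))
                                         (trans (∑-const (filter single? F) 1) (*-identityʳ _)))
                                  (trans (sym (∑-filter double? F _)) (∑-const doubles 3)))
                       (sym (length-filter-∑ (neg k ∈?_) F)) ⟩
        singles + length doubles * 3 + occ (neg k) F
          ≤⟨ +-monoʳ-≤ (singles + length doubles * 3) (neg-bound k) ⟩
        singles + length doubles * 3 + q
          ≤⟨ bound ⟩
        9 ∎
        where open ≤-Reasoning

      -- A survivor in the piece has `k` in its support. If `neg k` is missing, the bound on its
      -- weight halves: from 2 to 1, or from 4 to 2, which is below the 3 that is charged.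
      weight-charge : ∀ k {C} → C ∈ piece k → weight 2 θ C ≤ charge k C
      weight-charge k {C} C∈ with view (piece⊆ k C∈)
      ... | holds _ _ w≡0 rewrite w≡0 = z≤n
      ... | active A eq 1≤ with find (proj₂ (∈-filter⁻ (keyed? k) {xs = F} C∈))
      ...   | l , l∈C , _ , refl with active-weight (piece⊆ k C∈) A | active-weight-∉ (piece⊆ k C∈) A (key∈S (piece⊆ k C∈) A l∈C)
      ...     | w≤ | w≤∉ rewrite sym eq with size C | size≤2 (piece⊆ k C∈) | neg k ∈? C
      ...       | 1 | _ | yes _ = w≤
      ...       | 1 | _ | no k̄∉C = *-cancelˡ-≤ 2 (w≤∉ k̄∉C)
      ...       | 2 | _ | yes _ = w≤
      ...       | 2 | _ | no k̄∉C = ≤-trans (*-cancelˡ-≤ {weight 2 θ C} {2} 2 (w≤∉ k̄∉C)) (m≤m+n 2 1)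
      ...       | suc (suc (suc _)) | s≤s (s≤s ()) | _

      light-or-forced : ∀ {C} → C ∈ F → Settled θ C ⊎ weight 2 θ C ≤ 2 × Any Negative C
      light-or-forced {C} C∈F with view C∈F
      ... | holds true! _ _ = inj₁ (Any.map inj₁ true!)
      ... | active A eq 1≤ with double? C
      ...   | yes 2≤ with forced (∈-filter⁺ double? C∈F 2≤)
      ...     | l , l∈C , unset , _ = inj₁ (lose l∈C (inj₂ unset))
      light-or-forced {C} C∈F | active A eq 1≤ | no 2≰ =
        inj₂ (≤-trans (weight-size C∈F 1≤) (^-monoʳ-≤ 2 (s≤s⁻¹ (≰⇒> 2≰))) , active-has-negative C∈F A)

      piece-extension : ∀ k → Extension θ (piece k)
      piece-extension k = extend-medium (clauses ∘ piece⊆ k)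
        (λ C∈ D∈ → pos-once (piece⊆ k C∈) (piece⊆ k D∈)) θ
        (≤-trans (∑-mono (piece k) (weight-charge k)) (≤-trans (∑-filter-≤ (keyed? k) F (charge k)) (∑-charge k)))
        (light-or-forced ∘ piece⊆ k)

      -- With a support of size one, every key is its only element; with a support of size two,
      -- `forced` leaves a single unassigned literal.
      same-key : ∀ {C} → C ∈ F → Active C → ∀ {l l′} → l ∈ C → l′ ∈ C →
                 IsUnset θ l → IsUnset θ l′ → key (var l) ≡ key (var l′)
      same-key {C} C∈F A l∈C l′∈C unset unset′ with double? C
      ... | yes 2≤ with forced (∈-filter⁺ double? C∈F 2≤)
      ...   | _ , _ , _ , only rewrite only l∈C unset | only l′∈C unset′ = refl
      same-key {C} C∈F A l∈C l′∈C unset unset′ | no 2≰ with view C∈F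
      ... | holds true! _ _ = contradiction true! (Active.not-true A)
      ... | active A′ eq 1≤ = singleton (trans (sym eq) (≤-antisym (s≤s⁻¹ (≰⇒> 2≰)) 1≤)) (key∈S C∈F A′ l∈C) (key∈S C∈F A′ l′∈C)

      module _ (extension : ∀ k → Extension θ (piece k)) where

        α : ℕ → Assignment
        α k = proj₁ (extension k)

        θ⊑α : ∀ k → θ ⊑ (just ∘ α k)
        θ⊑α k = proj₁ (proj₂ (extension k))

        glued : Assignment
        glued v = α (key v) v

        eval-glued : ∀ l → evalLit (α (key (var l))) l ≡ evalLit glued l
        eval-glued (pos v) = refl
        eval-glued (neg v) = refl

        -- Take the extension for the key of some unassigned literal. The literal that it makes true
        -- was neither true nor false under `θ`, so it was unassigned, and by `same-key` the glued
        -- assignment evaluates it by this same extension.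
        satisfied-glued : ∀ {C} → C ∈ F → SatisfiedBy glued C
        satisfied-glued {C} C∈F with view C∈F
        ... | holds true! _ _ with find true!
        ...   | l , l∈C , l-true = lose l∈C (trans (sym (eval-glued l)) (⊑-true (λ {v} → θ⊑α (key (var l)) {v}) l l-true))
        satisfied-glued {C} C∈F | active A eq 1≤ with unset-literal C∈F A (size≤2 C∈F)
        ... | l , l∈C , unset with find (proj₂ (proj₂ (extension (key (var l)))) 
                                              (∈-filter⁺ (keyed? _) C∈F (lose l∈C (unset , refl))))
        ...   | l′ , l′∈C , l′-holds with value θ l′ in eq′
        ...     | just true = contradiction (lose l′∈C eq′) (Active.not-true A)
        ...     | just false = case trans (sym (⊑-value {θ} (λ {v} → θ⊑α (key (var l)) {v}) l′ eq′))
                                           (trans (value-total _ l′) (cong just l′-holds)) of λ ()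
        ...     | nothing = lose l′∈C (trans (sym (eval-glued l′))
                    (subst (λ k → evalLit (α k) l′ ≡ true) (same-key C∈F A l∈C l′∈C unset eq′) l′-holds))

      satisfiable : Satisfiable F
      satisfiable = glued piece-extension , All.tabulate (satisfied-glued piece-extension)

    ∑-weight : ∑ F (weight 2 θ) ≤ singles * 2 + ∑ doubles (weight 2 θ)
    ∑-weight = begin
      ∑ F (weight 2 θ)
        ≤⟨ ∑-mono F pointwise ⟩
      ∑ F (λ C → indicator (single? C) * 2 + indicator (double? C) * weight 2 θ C)
        ≡⟨ ∑-+ F ⟩
      ∑ F (λ C → indicator (single? C) * 2) + ∑ F (λ C → indicator (double? C) * weight 2 θ C)
        ≡⟨ cong₂ _+_ (trans (sym (∑-filter single? F _)) (∑-const (filter single? F) 2)) (sym (∑-filter double? F _)) ⟩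
      singles * 2 + ∑ doubles (weight 2 θ) ∎
      where
      open ≤-Reasoning
      pointwise : ∀ {C} → C ∈ F → weight 2 θ C ≤ indicator (single? C) * 2 + indicator (double? C) * weight 2 θ C
      pointwise {C} C∈F with view C∈F
      ... | holds _ _ w≡0 rewrite w≡0 = z≤n
      ... | active A eq 1≤ with weight-size C∈F 1≤
      ...   | w≤ with size C
      ...     | 1 = w≤
      ...     | suc (suc _) = ≤-reflexive (sym (+-identityʳ _))

    extension-satisfies : Extension θ F → Satisfiable F
    extension-satisfies (α , _ , sat) = α , All.tabulate sat

    -- Case distinction on the survivors with supports of size two

    module Cases (size≤2 : ∀ {C} → C ∈ F → size C ≤ 2) where

      weight≤4 : ∀ {D} → D ∈ doubles → weight 2 θ D ≤ 4
      weight≤4 D∈ with ∈-filter⁻ double? {xs = F} D∈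
      ... | D∈F , 2≤ = ≤-trans (weight-size D∈F (≤-trans (s≤s z≤n) 2≤)) (^-monoʳ-≤ 2 (size≤2 D∈F))

      satisfiable₀ : doubles ≡ [] → singles + q ≤ 9 → Satisfiable F
      satisfiable₀ none bound = Glue.satisfiable size≤2
        (subst (λ Ds → singles + length Ds * 3 + q ≤ 9) (sym none)
          (subst (λ n → n + q ≤ 9) (sym (+-identityʳ singles)) bound))
        (λ D∈ → case subst (_ ∈_) none D∈ of λ ())

      module _ {D} (one : doubles ≡ D ∷ []) where

        private
          D∈ : D ∈ doubles
          D∈ = subst (D ∈_) (sym one) (here refl)

          only-D : ∀ {C} → C ∈ F → 2 ≤ size C → C ≡ D
          only-D C∈F 2≤ with subst (_ ∈_) one (∈-filter⁺ double? C∈F 2≤)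
          ... | here C≡D = C≡D

          D∈F : D ∈ F
          D∈F = proj₁ (∈-filter⁻ double? D∈)

        -- The total 3 * 2 + 2 = 8 just misses `extend-light`, but all weights are at most 2, as
        -- `extend-medium` requires.
        satisfiable-light : singles ≤ 3 → weight 2 θ D ≤ 2 → Satisfiable F
        satisfiable-light ≤3 w≤2 = extension-satisfies (extend-medium clauses pos-once θ ∑≤9 hyp)
          where
          ∑≤9 : ∑ F (weight 2 θ) ≤ 9
          ∑≤9 = ≤-trans ∑-weight (subst (λ Ds → singles * 2 + ∑ Ds (weight 2 θ) ≤ 9) (sym one)
            (≤-trans (+-mono-≤ (*-monoˡ-≤ 2 ≤3) (+-mono-≤ w≤2 z≤n)) (m≤m+n 8 1)))
          hyp : ∀ {C} → C ∈ F → Settled θ C ⊎ weight 2 θ C ≤ 2 × Any Negative C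
          hyp {C} C∈F with view C∈F
          ... | holds true! _ _ = inj₁ (Any.map inj₁ true!)
          ... | active A _ 1≤ with double? C
          ...   | yes 2≤ rewrite only-D C∈F 2≤ = inj₂ (w≤2 , active-has-negative D∈F A)
          ...   | no 2≰ = inj₂ (≤-trans (weight-size C∈F 1≤) (^-monoʳ-≤ 2 (s≤s⁻¹ (≰⇒> 2≰))) , active-has-negative C∈F A)

        -- Survivors with a support of size one cannot contain ¬u, as the support of u has size two.
        satisfiable-pos : singles ≤ 3 → ∀ {u} → pos u ∈ D → θ u ≡ nothing → Satisfiable F
        satisfiable-pos ≤3 {u} u∈D u? = extension-satisfies
          (⊑-Extension {θ} (set-⊑ {θ} (pos u) u?) (extend-light clauses (set θ (pos u)) (begin-strict
            ∑ F (weight 2 (set θ (pos u)))          ≤⟨ ∑-mono F pointwise ⟩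
            ∑ F (λ C → indicator (single? C) * 2)   ≡⟨ trans (sym (∑-filter single? F _)) (∑-const (filter single? F) 2) ⟩
            singles * 2                             ≤⟨ *-monoˡ-≤ 2 ≤3 ⟩
            6                                       <⟨ m≤m+n 7 1 ⟩
            8                                       ∎)))
          where
          open ≤-Reasoning
          no-pair : ∀ {S T : List ℕ} → Unique T → 2 ≤ length T → T ⊆ S → length S ≢ 1
          no-pair {T = s ∷ t ∷ _} ((s≢t ∷ _) ∷ _) _ T⊆S one = s≢t (singleton one (T⊆S (here refl)) (T⊆S (there (here refl))))
          no-pair {T = _ ∷ []} _ (s≤s ())
          pointwise : ∀ {C} → C ∈ F → weight 2 (set θ (pos u)) C ≤ indicator (single? C) * 2
          pointwise {C} C∈F with view C∈F
          ... | holds true! _ _ with find true!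
          ...   | l , l∈C , l-true
            rewrite weight-satisfied {2} {σ = set θ (pos u)} l∈C (⊑-value {θ} (λ {v} → set-⊑ {θ} (pos u) u? {v}) l l-true) = z≤n
          pointwise {C} C∈F | active A eq 1≤ with double? C
          ... | yes 2≤ rewrite only-D C∈F 2≤ | weight-satisfied {2} {σ = set θ (pos u)} u∈D (value-set {θ} (pos u)) = z≤n
          ... | no 2≰ with view D∈F
          ...   | holds _ size≡0 _ = case subst (2 ≤_) size≡0 (proj₂ (∈-filter⁻ double? {xs = F} D∈)) of λ ()
          ...   | active B eqB _ with ≤-antisym (s≤s⁻¹ (≰⇒> 2≰)) 1≤
          ...     | size≡1 rewrite indicator-yes (single? C) size≡1 =
            ≤-trans (weight-set-∉ (pos u) u? C ū∉C) (subst (λ n → weight 2 θ C ≤ 2 ^ n) size≡1 (weight-size C∈F 1≤))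
            where
            ū∉C : neg u ∉ C
            ū∉C ū∈C with active-neg C∈F A ū∈C
            ... | T , equ , T⊆S with just-injective (trans (sym equ) (active-pos D∈F B u∈D))
            ...   | refl = no-pair (S-unique D∈F B) (subst (2 ≤_) eqB (proj₂ (∈-filter⁻ double? {xs = F} D∈))) T⊆S
                                   (trans (sym eq) size≡1)

        -- If the weight of `D` exceeds 2, then `D` is either satisfied through its only unassigned
        -- literal when this is positive, or it is forced in the sense of `Glue` when this is
        -- negative.
        satisfiable₁ : singles + 3 + q ≤ 9 → singles ≤ 3 → Satisfiable F
        satisfiable₁ bound ≤3 with weight 2 θ D ≤? 2
        ... | yes w≤2 = satisfiable-light ≤3 w≤2
        ... | no w≰2 with one-unset (clauses D∈F) not-true (≰⇒> w≰2) (weight≤4 D∈)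
          where
          not-true : ¬ Any (IsTrue θ) D
          not-true true! = w≰2 (subst (_≤ 2) (sym (weight-true true!)) z≤n)
        ... | pos u , u∈D , u? , only = satisfiable-pos ≤3 u∈D u?
        ... | neg u , ū∈D , ū? , only = Glue.satisfiable size≤2
          (subst (λ Ds → singles + length Ds * 3 + q ≤ 9) (sym one) bound)
          (λ D′∈ → case subst (_ ∈_) one D′∈ of λ { (here refl) → neg u , ū∈D , (ū? , refl) , λ {l′} → only {l′} })

      -- The excluded pair could weigh 4 + 4 = 8; otherwise the total is at most 2 + 4.
      satisfiable₂ : ∀ {D E} → doubles ≡ D ∷ E ∷ [] → singles ≡ 0 →
                     ¬ (3 ≤ weight 2 θ D × 3 ≤ weight 2 θ E) → Satisfiable F
      satisfiable₂ {D} {E} two zero-singles not-both = extension-satisfies (extend-light clauses θ (s≤s (begin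
        ∑ F (weight 2 θ)
          ≤⟨ ∑-weight ⟩
        singles * 2 + ∑ doubles (weight 2 θ)
          ≡⟨ cong₂ (λ n Ds → n * 2 + ∑ Ds (weight 2 θ)) zero-singles two ⟩
        weight 2 θ D + (weight 2 θ E + 0)
          ≡⟨ cong (weight 2 θ D +_) (+-identityʳ _) ⟩
        weight 2 θ D + weight 2 θ E
          ≤⟨ sum≤6 ⟩
        6 ≤⟨ n≤1+n 6 ⟩
        7 ∎)))
        where
        open ≤-Reasoning
        D≤4 : weight 2 θ D ≤ 4
        D≤4 = weight≤4 (subst (D ∈_) (sym two) (here refl))
        E≤4 : weight 2 θ E ≤ 4
        E≤4 = weight≤4 (subst (E ∈_) (sym two) (there (here refl)))
        sum≤6 : weight 2 θ D + weight 2 θ E ≤ 6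
        sum≤6 with 3 ≤? weight 2 θ D | 3 ≤? weight 2 θ E
        ... | yes 3≤D | yes 3≤E = contradiction (3≤D , 3≤E) not-both
        ... | no 3≰D  | _       = +-mono-≤ (s≤s⁻¹ (≰⇒> 3≰D)) E≤4
        ... | yes _   | no 3≰E  = +-mono-≤ D≤4 (s≤s⁻¹ (≰⇒> 3≰E))

    -- The budget for survivors

    module Budget (p : ℕ) where

      open Cost p

      charge : Clause → ℕ
      charge C = cost C * weight 3 τ (choices C)

      -- The support of a survivor was chosen in full, so every literal of `choices C` is false and
      -- contributes a factor 3.
      ≤-charge : ∀ {C} → C ∈ F → 1 ≤ size C → (12 + p * uses C) * 3 ^ size C ≤ charge C
      ≤-charge {C} C∈F 1≤ with view C∈F
      ... | holds _ size≡0 _ = case subst (1 ≤_) size≡0 1≤ of λ ()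
      ... | active A eq _ rewrite eq with root? C
      ...   | yes root = contradiction root (Active.nonroot A)
      ...   | no _ rewrite Active.C-support A = ≤-reflexive (cong ((12 + p * uses C) *_) (sym
        (trans (weight-all-false 3 (map neg (Active.S A))
                 (Allₚ.map⁺ (All.map (cong (Maybe.map not)) (Active.selected A))))
               (cong (3 ^_) (length-map neg (Active.S A))))))

      12≤ : ∀ C → 12 ≤ 12 + p * uses C
      12≤ C = m≤m+n 12 _

      ∑-charge : singles * 36 + ∑ doubles charge ≤ ∑ F charge
      ∑-charge = begin
        singles * 36 + ∑ doubles charge
          ≡⟨ cong₂ _+_ (trans (sym (∑-const (filter single? F) 36)) (∑-filter single? F _)) (∑-filter double? F _) ⟩
        ∑ F (λ C → indicator (single? C) * 36) + ∑ F (λ C → indicator (double? C) * charge C)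
          ≡⟨ ∑-+ F ⟨
        ∑ F (λ C → indicator (single? C) * 36 + indicator (double? C) * charge C)
          ≤⟨ ∑-mono F pointwise ⟩
        ∑ F charge ∎
        where
        open ≤-Reasoning
        pointwise : ∀ {C} → C ∈ F → indicator (single? C) * 36 + indicator (double? C) * charge C ≤ charge C
        pointwise {C} C∈F with ≤-charge C∈F
        ... | ≤charge with size C
        ...   | 0 = z≤n
        ...   | 1 = ≤-trans (*-monoˡ-≤ 3 (12≤ C)) (≤charge ≤-refl)
        ...   | suc (suc _) = ≤-reflexive (+-identityʳ _)

      double-charge : ∀ {D} → D ∈ doubles → (12 + p * uses D) * 9 ≤ charge D
      double-charge {D} D∈ with ∈-filter⁻ double? {xs = F} D∈
      ... | D∈F , 2≤ = ≤-trans (*-monoʳ-≤ (12 + p * uses D) (^-monoʳ-≤ 3 2≤)) (≤-charge D∈F (≤-trans (s≤s z≤n) 2≤))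

      108≤charge : ∀ {D} → D ∈ doubles → 108 ≤ charge D
      108≤charge {D} D∈ = ≤-trans (*-monoˡ-≤ 9 (12≤ D)) (double-charge D∈)

      -- A single survivor with three variables in its support would cost 12 * 27 = 324.
      size≤2 : ∑ F charge < 324 → ∀ {C} → C ∈ F → size C ≤ 2
      size≤2 ∑<324 {C} C∈F with size C ≤? 2
      ... | yes ≤2 = ≤2
      ... | no ≰2 = contradiction (<-≤-trans ∑<324 (begin
        324                               ≤⟨ *-monoˡ-≤ 27 (12≤ C) ⟩
        (12 + p * uses C) * 27            ≤⟨ *-monoʳ-≤ (12 + p * uses C) (^-monoʳ-≤ 3 (≰⇒> ≰2)) ⟩
        (12 + p * uses C) * 3 ^ size C    ≤⟨ ≤-charge C∈F (≤-trans (s≤s z≤n) (≰⇒> ≰2)) ⟩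
        charge C                          ≤⟨ ∑-∈ charge C∈F ⟩
        ∑ F charge                        ∎)) (<-irrefl refl)
        where open ≤-Reasoning

      -- By `active-uses` the weight is at most 2 to the number of uses.
      two-uses : ∀ {D} → D ∈ doubles → 3 ≤ weight 2 θ D → 2 ≤ uses D
      two-uses {D} D∈ 3≤ with view (proj₁ (∈-filter⁻ double? {xs = F} D∈))
      ... | holds _ _ w≡0 = case subst (3 ≤_) w≡0 3≤ of λ ()
      ... | active A _ _ with ≤-trans 3≤ (active-uses (proj₁ (∈-filter⁻ double? {xs = F} D∈)) A)
      ...   | 3≤2^ with uses D
      ...     | 0 = case 3≤2^ of λ { (s≤s ()) }
      ...     | 1 = case 3≤2^ of λ { (s≤s (s≤s ())) }
      ...     | suc (suc _) = s≤s (s≤s z≤n)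

    -- Singles cost 36 and doubles at least 108. Below 252 this allows six singles, three singles
    -- beside one double, or two doubles alone; 6 + 3 and 3 + 3 + 3 both meet the bound 9 of `Glue`
    -- exactly.
    satisfiable-3 : q ≡ 3 → ∑ F (Budget.charge 1) < 252 → Satisfiable F
    satisfiable-3 q≡3 ∑<252 = go doubles refl
      where
      open Budget 1
      open Cases (size≤2 (≤-trans ∑<252 (m≤m+n 252 72)))
      go : ∀ Ds → doubles ≡ Ds → Satisfiable F
      below : ∀ {Ds} → doubles ≡ Ds → singles * 36 + ∑ Ds charge < 252
      below refl = ≤-<-trans ∑-charge ∑<252
      go [] eq = satisfiable₀ eq (subst (λ n → singles + n ≤ 9) (sym q≡3) (+-monoˡ-≤ 3 (s≤s⁻¹ singles<7)))
        where
        singles<7 : singles < 7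
        singles<7 = *-cancelʳ-< 36 singles 7 (≤-<-trans (m≤m+n _ 0) (below eq))
      go (D ∷ []) eq = satisfiable₁ eq
        (subst (λ n → singles + 3 + n ≤ 9) (sym q≡3) (+-monoˡ-≤ 3 (+-monoˡ-≤ 3 (s≤s⁻¹ singles<4))))
        (s≤s⁻¹ singles<4)
        where
        singles<4 : singles < 4
        singles<4 = *-cancelʳ-< 36 singles 4 (+-cancelʳ-< 108 (singles * 36) 144
          (≤-<-trans (+-monoʳ-≤ (singles * 36) (≤-trans (108≤charge (subst (D ∈_) (sym eq) (here refl))) (m≤m+n _ 0))) (below eq)))
      go (D ∷ E ∷ []) eq = satisfiable₂ eq (n<1⇒n≡0 singles<1) λ (3≤D , 3≤E) →
        <-irrefl refl (≤-<-trans (+-mono-≤ (126≤ D∈ 3≤D) (+-mono-≤ (126≤ E∈ 3≤E) z≤n))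
          (≤-<-trans (m≤n+m _ (singles * 36)) (below eq)))
        where
        D∈ : D ∈ doubles
        D∈ = subst (D ∈_) (sym eq) (here refl)
        E∈ : E ∈ doubles
        E∈ = subst (E ∈_) (sym eq) (there (here refl))
        -- The surcharge for two uses raises 12 * 9 to 14 * 9 = 126, and two such doubles reach 252.
        126≤ : ∀ {D} → D ∈ doubles → 3 ≤ weight 2 θ D → 126 ≤ charge D
        126≤ {D} D∈ 3≤ = ≤-trans (*-monoˡ-≤ 9 (+-monoʳ-≤ 12 (*-monoʳ-≤ 1 (two-uses D∈ 3≤)))) (double-charge D∈)
        singles<1 : singles < 1
        singles<1 = *-cancelʳ-< 36 singles 1 (+-cancelʳ-< 216 (singles * 36) 36
          (≤-<-trans (+-monoʳ-≤ (singles * 36) (+-mono-≤ (108≤charge D∈) (+-mono-≤ (108≤charge E∈) z≤n))) (below eq)))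
      go (D ∷ E ∷ G ∷ Ds) eq = contradiction (≤-<-trans (m≤n+m _ (singles * 36)) (below eq))
        (≤⇒≯ (≤-trans (m≤m+n 252 72)
        (+-mono-≤ (108≤charge (subst (D ∈_) (sym eq) (here refl)))
          (+-mono-≤ (108≤charge (subst (E ∈_) (sym eq) (there (here refl))))
            (≤-trans (108≤charge (subst (G ∈_) (sym eq) (there (there (here refl))))) (m≤m+n _ _))))))

    -- Two doubles already reach 216, so `p` can be 0. What remains is five singles, or two singles
    -- beside one double, and 5 + 4 = 2 + 3 + 4 = 9.
    satisfiable-4 : q ≡ 4 → ∑ F (Budget.charge 0) < 216 → Satisfiable F
    satisfiable-4 q≡4 ∑<216 = go doubles refl
      where
      open Budget 0
      open Cases (size≤2 (≤-trans ∑<216 (m≤m+n 216 108)))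
      go : ∀ Ds → doubles ≡ Ds → Satisfiable F
      below : ∀ {Ds} → doubles ≡ Ds → singles * 36 + ∑ Ds charge < 216
      below refl = ≤-<-trans ∑-charge ∑<216
      go [] eq = satisfiable₀ eq (subst (λ n → singles + n ≤ 9) (sym q≡4) (+-monoˡ-≤ 4 (s≤s⁻¹ singles<6)))
        where
        singles<6 : singles < 6
        singles<6 = *-cancelʳ-< 36 singles 6 (≤-<-trans (m≤m+n _ 0) (below eq))
      go (D ∷ []) eq = satisfiable₁ eq
        (subst (λ n → singles + 3 + n ≤ 9) (sym q≡4) (+-monoˡ-≤ 4 (+-monoˡ-≤ 3 (s≤s⁻¹ singles<3))))
        (≤-trans (s≤s⁻¹ singles<3) (n≤1+n 2))
        where
        singles<3 : singles < 3
        singles<3 = *-cancelʳ-< 36 singles 3 (+-cancelʳ-< 108 (singles * 36) 108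
          (≤-<-trans (+-monoʳ-≤ (singles * 36) (≤-trans (108≤charge (subst (D ∈_) (sym eq) (here refl))) (m≤m+n _ 0))) (below eq)))
      go (D ∷ E ∷ Ds) eq = contradiction (≤-<-trans (m≤n+m _ (singles * 36)) (below eq)) (≤⇒≯
        (+-mono-≤ (108≤charge (subst (D ∈_) (sym eq) (here refl)))
          (≤-trans (108≤charge (subst (E ∈_) (sym eq) (there (here refl)))) (m≤m+n _ _))))

  -- Every clause has a negative literal. Treating this case apart provides the block that makes the
  -- budget strict.
  root-free : blocks ≡ [] → Satisfiable F
  root-free none = (λ _ → false) , All.tabulate λ {C} C∈F → case root? C of λ where
    (yes root)   → case subst (C ∈_) none (∈-filter⁺ root? C∈F root) of λ ()
    (no nonroot) → lose (proj₂ (negative-literal nonroot)) refl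

  -- By `pos-once`, blocks that share a variable coincide, against `distinct`.
  blocks-disjoint : AllPairs (λ B B′ → ∀ {l} → l ∈ B → l ∉ B′) blocks
  blocks-disjoint = go blocks (λ B∈ → B∈) (AllPairsₚ.filter⁺ root? distinct)
    where
    go : ∀ Bs → Bs ⊆ blocks → AllPairs (λ B B′ → ¬ (B ↭ B′)) Bs → AllPairs (λ B B′ → ∀ {l} → l ∈ B → l ∉ B′) Bs
    go [] _ _ = []
    go (B ∷ Bs) Bs⊆ (B≁ ∷ Bs≁) = All.tabulate apart ∷ go Bs (Bs⊆ ∘ there) Bs≁
      where
      apart : ∀ {B′} → B′ ∈ Bs → ∀ {l} → l ∈ B → l ∉ B′
      apart B′∈ {pos x} x∈B x∈B′ = All.lookup B≁ B′∈
        (↭-reflexive (pos-once (proj₁ (∈-filter⁻ root? (Bs⊆ (here refl))))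
                                (proj₁ (∈-filter⁻ root? (Bs⊆ (there B′∈)))) x∈B x∈B′))
      apart B′∈ {neg x} x̄∈B _ = case All.lookup (proj₂ (∈-filter⁻ root? {xs = F} (Bs⊆ (here refl)))) x̄∈B of λ ()

  -- In the last hypothesis `r` is the number of blocks: what they save, 12 each, is weighed against
  -- the surcharges on their variables.
  satisfiable-within : ∀ p T →
    (∀ τ (sel : Selection (λ _ → nothing) blocks τ) → ∑ F (Chosen.Budget.charge τ sel p) < T → Satisfiable F) →
    (∀ r → 1 ≤ r → length F * 12 + p * (r * 3 * q) < T + r * 12) → Satisfiable F
  satisfiable-within p T cheap bound = go blocks refl
    where
    open Cost p
    go : ∀ Bs → blocks ≡ Bs → Satisfiable F
    go [] none = root-free none
    go (_ ∷ _) some with select F cost choices choices-unique choices-negative blocks (λ _ → nothing)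
      (λ B∈ → clauses (proj₁ (∈-filter⁻ root? B∈)) , proj₂ (∈-filter⁻ root? {xs = F} B∈)) blocks-disjoint (λ _ _ → refl)
    ... | τ , sel , ≤total₀ = cheap τ sel (≤-<-trans (≤-trans ≤total₀ (≤-reflexive total₀))
      (+-cancelʳ-< (length blocks * 12) (∑ F cost) T
        (≤-<-trans ∑-cost (bound (length blocks) (subst (λ Bs → 1 ≤ length Bs) (sym some) (s≤s z≤n))))))

-- The two bounds

at-most-one : ∀ {A : Set} {xs : List A} {x y} → length xs ≤ 1 → x ∈ xs → y ∈ xs → x ≡ y
at-most-one {xs = _ ∷ []}    _        (here refl) (here refl) = refl
at-most-one {xs = _ ∷ _ ∷ _} (s≤s ())

module Formula {q} (F : CNF) (formula : Is-kpq-formula 3 1 q F) where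

  private
    clauses : ∀ {C} → C ∈ F → Is3Clause C
    clauses C∈F = All.lookup (proj₁ (proj₁ formula)) C∈F , All.lookup (proj₁ (proj₂ formula)) C∈F

    pos-once : ∀ {x C D} → C ∈ F → D ∈ F → pos x ∈ C → pos x ∈ D → C ≡ D
    pos-once {x} C∈F D∈F x∈C x∈D = at-most-one (proj₁ (proj₂ (proj₂ formula)) x)
      (∈-filter⁺ (pos x ∈?_) C∈F x∈C) (∈-filter⁺ (pos x ∈?_) D∈F x∈D)

  descent : ∃ (Supported F)
  descent = supports F pos-once

  module Clauses {ρ} (supported : Supported F ρ) =
    Analysis F q clauses pos-once (proj₂ (proj₂ (proj₂ formula))) (proj₂ (proj₁ formula)) ρ supported

satisfiable-21 : ∀ F → Is-kpq-formula 3 1 3 F → length F ≤ 21 → Satisfiable F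
satisfiable-21 F formula ≤21 with Formula.descent F formula
... | _ , supported = satisfiable-within 1 252 (λ τ selection → Chosen.satisfiable-3 τ selection refl) bound
  where
  open Formula.Clauses F formula supported
  open ≤-Reasoning
  bound : ∀ r → 1 ≤ r → length F * 12 + 1 * (r * 3 * 3) < 252 + r * 12
  bound r 1≤r = +-mono-≤-< (*-monoˡ-≤ 12 ≤21) (begin-strict
    1 * (r * 3 * 3)  ≡⟨ trans (*-identityˡ _) (*-assoc r 3 3) ⟩
    r * 9            <⟨ *-monoʳ-< r {{>-nonZero 1≤r}} (m≤m+n 10 2) ⟩
    r * 12           ∎)

satisfiable-18 : ∀ F → Is-kpq-formula 3 1 4 F → length F ≤ 18 → Satisfiable F
satisfiable-18 F formula ≤18 with Formula.descent F formula
... | _ , supported = satisfiable-within 0 216 (λ τ selection → Chosen.satisfiable-4 τ selection refl)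
    (λ r 1≤r → +-mono-≤-< (*-monoˡ-≤ 12 ≤18) (*-mono-≤ 1≤r (s≤s z≤n)))
  where open Formula.Clauses F formula supported

theorem11 : μ≥ 3 1 3 22 × μ≥ 3 1 4 19
theorem11 = (λ F formula unsat → ≰⇒> λ ≤21 → unsat (satisfiable-21 F formula ≤21))
          , (λ F formula unsat → ≰⇒> λ ≤18 → unsat (satisfiable-18 F formula ≤18))
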